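{- The family of permutahedra, oriented by the weak Bruhat order, has asymptotic $k$-length $1$ for all $k\ge1$, and therefore asymptotic total length $1$.
   Context: An oriented polytope is a convex polytope $P\subset\mathbb{R}^d$ together with a linear functional $\psi$ that is not constant along any edge of $P$. The functional orients each edge, and the vertex set of $P$ becomes a poset by taking the reflexive-transitive closure of this orientation. Every nonempty face has a unique bottom vertex and a unique top vertex. For nonempty faces $F,G$ write $F\le G$ if the top vertex of $F$ is less than or equal to the bottom vertex of $G$ in the vertex poset of $P$. A face chain of length $k$ in $P$ is a sequence $\mathbf{F}=(F_1\le F_2\le\cdots\le F_k)$ of nonempty faces of $P$. Its excess is $\mathrm{exc}(\mathbf{F})=(\dim P-1)-\sum_{i=1}^k(\dim F_i-1)$. Let $e_k(P)$ be the minimum excess of a length $k$ face chain in $P$ (for $k=1$ the trivial chain consisting of $P$ itself is excluded). Let $E_k(n)=(n-1)-k(n-2)=(1-k)n+2k-1$. A family of polytopes $P^\bullet$ consists of one oriented polytope $P^n$ of dimension $n$ for each $n\ge1$. The family has asymptotic $k$-length $\alpha_k$ if $\lim_{n\to\infty} e_k(P^n)/E_k(n)=\alpha_k$. It has asymptotic total length $\alpha$ if the $\alpha_k$ are well-defined for every $k$ and $\lim_{k\to\infty}\alpha_k=\alpha$. The permutahedron $\mathbb{P}^N\subset\mathbb{R}^N$ is the convex hull of the points $(\sigma(1),\ldots,\sigma(N))$, $\sigma\in S_N$. It has dimension $N-1$, so the $n$-dimensional member of the family of permutahedra is $\mathbb{P}^{n+1}$. Its nonempty faces are labelled by ordered set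 partitions of $\{1,\ldots,N\}$ (sequences of disjoint nonempty parts with union $\{1,\ldots,N\}$), face inclusion corresponding to refinement of ordered partitions. The face labelled by an ordered partition with $p$ parts has dimension $N-p$. A vertex corresponds to an ordered partition into singletons, i.e. a permutation, and its coordinates are given by the inverse permutation. The orientation comes from the functional $\psi(\mathbf{v})=\sum_{i=1}^N i\,\mathbf{v}_i$, with edges directed so that the vertex labelled $[1][2]\cdots[N]$ is the minimum (i.e. in the direction of decreasing $\psi$). The resulting vertex poset is the weak Bruhat order. For an ordered partition $\tau$ let $\tau(i)$ be the index of the part of $\tau$ containing $i$. In these terms, the relation $\tau\le\rho$ on faces holds if and only if for every pair $i<j$ one has $\tau(i)<\tau(j)$ or $\rho(i)>\rho(j)$ (strict inequalities).
   Formalization: The permutahedra are taken as convex hulls in rational instead of real coordinate space: points, convex weights, linear functionals cutting out faces, and the tolerance and values in the limits are all rational. -}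

module Defs where

open import Data.Bool.Base using (if_then_else_)
open import Data.Empty using (⊥)
open import Data.Fin.Base as Fin using (Fin; zero; suc; toℕ; inject₁)
import Data.Fin.Induction as Fin
open import Data.Fin.Permutation using (Permutation′; _⟨$⟩ʳ_; _⟨$⟩ˡ_; inverseˡ; inverseʳ; transpose; _∘ₚ_)
  renaming (id to idₚ)
import Data.Fin.Properties as Fin
open import Data.Integer.Base as ℤ using (ℤ; +_)
import Data.Integer.Properties as ℤ
open import Data.List.Base as List using (List)
open import Data.List.Membership.Propositional using (_∈_)
open import Data.List.Membership.Propositional.Properties
  using (∈-map⁺; ∈-allFin; ∈-cartesianProductWith⁺)
open import Data.List.Relation.Unary.Any using (here)
open import Data.Nat.Base as ℕ using (ℕ; zero; suc)
import Data.Nat.Coprimality as Coprime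
import Data.Nat.Properties as ℕ
open import Data.Product.Base using (Σ-syntax; ∃-syntax; _×_; _,_)
open import Data.Rational.Base as ℚ
  using (ℚ; 0ℚ; 1ℚ; _+_; _*_; _-_; -_; _≤_; _<_; ∣_∣; _/_; _÷_; 1/_)
import Data.Rational.Properties as ℚ
open import Data.Rational.Solver using (module +-*-Solver)
import Data.Rational.Unnormalised.Base as ℚᵘ
open import Data.Vec.Base as Vec using (Vec; []; _∷_; lookup; tabulate; replicate)
import Data.Vec.Properties as Vec
open import Data.Vec.Relation.Unary.Linked using (Linked)
open import Function.Base using (_∘_)
open import Level using (0ℓ)
open import Relation.Binary.Core using (Rel)
open import Relation.Binary.Definitions using (tri<; tri≈; tri>)
open import Relation.Binary.Construct.Closure.ReflexiveTransitive using (Star)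
open import Relation.Binary.PropositionalEquality
open import Relation.Nullary using (¬_; yes; no; does; contradiction)
open import Relation.Nullary.Decidable using (dec-true; dec-false)
open import Relation.Unary using (Pred; _⊆_)
import Algebra.Properties.Semiring.Sum as SemiringSum
open import Algebra.Bundles using (CommutativeRing)

open SemiringSum (CommutativeRing.semiring ℚ.+-*-commutativeRing)

-- All polytopes here have rational vertices, so coordinates, functionals and
-- normal vectors of faces are taken in ℚ instead of ℝ.

Point : ℕ → Set
Point d = Vec ℚ d

-- Linear functionals on ℚ^d are given by their coefficient vectors.
infix 8 _·_
_·_ : ∀ {d} → Point d → Point d → ℚ
c · p = ∑[ i < _ ] (lookup c i * lookup p i)

combine : ∀ {d m} → (Fin m → ℚ) → (Fin m → Point d) → Point d
combine w v = tabulate λ j → ∑[ i < _ ] (w i * lookup (v i) j)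

record ConvexHull {d} (S : Pred (Point d) 0ℓ) (p : Point d) : Set where
  field
    size        : ℕ
    weights     : Fin size → ℚ
    points      : Fin size → Point d
    points∈S    : ∀ i → S (points i)
    weights≥0   : ∀ i → 0ℚ ≤ weights i
    weights-sum : sum weights ≡ 1ℚ
    combination : p ≡ combine weights points

AffinelyIndependent : ∀ {d m} → (Fin m → Point d) → Set
AffinelyIndependent {d} v =
  ∀ w → sum w ≡ 0ℚ → combine w v ≡ replicate d 0ℚ → ∀ i → w i ≡ 0ℚ

-- The affine hull of S has dimension r: it has an affine basis of r + 1
-- elements of S.  In particular S is nonempty.
record HasDim {d} (S : Pred (Point d) 0ℓ) (r : ℕ) : Set where
  field
    basis       : Fin (suc r) → Point d
    basis∈S     : ∀ i → S (basis i)
    independent : AffinelyIndependent basis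
    spanning    : ∀ {p} → S p → ∃[ w ] sum w ≡ 1ℚ × p ≡ combine w basis

record Maximizers {d} (P : Pred (Point d) 0ℓ) (c p : Point d) : Set where
  constructor _,_
  field
    member  : P p
    maximal : ∀ {q} → P q → c · q ≤ c · p

open Maximizers

-- The nonempty faces of P, P itself included: the sets of points of P where some
-- linear functional attains its maximum over P.  The dimension of a face is
-- determined by its normal vector, and different normal vectors may give the same
-- face.
record Face {d} (P : Pred (Point d) 0ℓ) : Set where
  field
    normal : Point d
    dim    : ℕ
    hasDim : HasDim (Maximizers P normal) dim

  carrier : Pred (Point d) 0ℓ
  carrier = Maximizers P normal

open Face using (carrier)

ConstantOn : ∀ {d} → Point d → Pred (Point d) 0ℓ → Set
ConstantOn ψ S = ∀ {p q} → S p → S q → ψ · p ≡ ψ · q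

record OrientedPolytope : Set₁ where
  field
    ambient     : ℕ
    generator   : Pred (Point ambient) 0ℓ
    finite      : ∃[ xs ] (∀ {p} → generator p → p ∈ xs)
    dim         : ℕ
    hasDim      : HasDim (ConvexHull generator) dim
    ψ           : Point ambient
    nonconstant : ∀ (E : Face (ConvexHull generator)) → Face.dim E ≡ 1 →
                  ¬ ConstantOn ψ (carrier E)

  polytope : Pred (Point ambient) 0ℓ
  polytope = ConvexHull generator

module _ (P : OrientedPolytope) where
  open OrientedPolytope P

  IsVertex : Pred (Point ambient) 0ℓ
  IsVertex v = Σ[ F ∈ Face polytope ] Face.dim F ≡ 0 × carrier F v

  -- Edges point in the direction of decreasing ψ, so bottom vertices maximise ψ.
  record Arrow (u v : Point ambient) : Set where
    field
      edge       : Face polytope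
      edge-dim   : Face.dim edge ≡ 1
      u-vertex   : IsVertex u
      v-vertex   : IsVertex v
      u∈edge     : carrier edge u
      v∈edge     : carrier edge v
      decreasing : ψ · v < ψ · u

  _≼_ : Rel (Point ambient) 0ℓ
  _≼_ = Star Arrow

  IsBottom IsTop : Face polytope → Pred (Point ambient) 0ℓ
  IsBottom F b = IsVertex b × carrier F b × (∀ {v} → IsVertex v → carrier F v → b ≼ v)
  IsTop    F t = IsVertex t × carrier F t × (∀ {v} → IsVertex v → carrier F v → v ≼ t)

  _≤ᶠ_ : Rel (Face polytope) 0ℓ
  F ≤ᶠ G = ∃[ t ] ∃[ b ] IsTop F t × IsBottom G b × t ≼ b

  -- The one-term sequence consisting of P itself.
  Trivial : ∀ {k} → Vec (Face polytope) k → Set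
  Trivial (F ∷ []) = polytope ⊆ carrier F
  Trivial _        = ⊥

  record FaceChain (k : ℕ) : Set where
    field
      faces      : Vec (Face polytope) k
      ascending  : Linked _≤ᶠ_ faces
      nontrivial : ¬ Trivial faces

  excess : ∀ {k} → FaceChain k → ℤ
  excess 𝐅 = (+ dim ℤ.- + 1) ℤ.-
    Vec.foldr′ ℤ._+_ (+ 0) (Vec.map (λ F → + Face.dim F ℤ.- + 1) (FaceChain.faces 𝐅))

  IsMinimumExcess : ℕ → ℤ → Set
  IsMinimumExcess k e = (Σ[ 𝐅 ∈ FaceChain k ] excess 𝐅 ≡ e)
                      × (∀ (𝐅 : FaceChain k) → e ℤ.≤ excess 𝐅)

E : ℕ → ℕ → ℤ
E k n = (+ n ℤ.- + 1) ℤ.- + k ℤ.* (+ n ℤ.- + 2)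

record Family : Set₁ where
  field
    polytopeOfDim : ∀ n → .{{ℕ.NonZero n}} → OrientedPolytope
    dim-correct   : ∀ n → .{{_ : ℕ.NonZero n}} → OrientedPolytope.dim (polytopeOfDim n) ≡ n

-- Limits of sequences given by their graphs, since E 2 3 ≡ 0 leaves the ratio
-- e_k(Pⁿ) / E_k(n) undefined at k = 2, n = 3.  All terms from N on have to be
-- defined.
Tendsto : (ℕ → Pred ℚ 0ℓ) → ℚ → Set
Tendsto x α = ∀ ε → 0ℚ < ε → ∃[ N ] (∀ n → N ℕ.≤ n → ∃[ q ] x n q × ∣ q - α ∣ < ε)

Ratio : ℤ → ℤ → Pred ℚ 0ℓ
Ratio a b q = Σ[ nz ∈ ℚ.NonZero (b / 1) ] q ≡ ((a / 1) ÷ (b / 1)) {{nz}}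

HasAsymptoticLength : Family → ℕ → ℚ → Set
HasAsymptoticLength 𝓟 k α = Σ[ e ∈ (ℕ → ℤ) ]
  (∀ n → .{{_ : ℕ.NonZero n}} → IsMinimumExcess (Family.polytopeOfDim 𝓟 n) k (e n))
  × Tendsto (λ n → Ratio (e n) (E k n)) α

HasAsymptoticTotalLength : Family → ℚ → Set
HasAsymptoticTotalLength 𝓟 α = Σ[ αₖ ∈ (ℕ → ℚ) ]
  (∀ k → .{{ℕ.NonZero k}} → HasAsymptoticLength 𝓟 k (αₖ k))
  × Tendsto (λ k q → q ≡ αₖ k) α

-- The coordinate with index i : Fin N stands for i + 1 ∈ {1,…,N}.
⌜_⌝ : ∀ {N} → Fin N → ℚ
⌜ i ⌝ = ℚ.mkℚ (+ suc (toℕ i)) 0 (Coprime.sym (Coprime.1-coprimeTo _))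

permPoint : ∀ {N} → Permutation′ N → Point N
permPoint σ = tabulate λ i → ⌜ σ ⟨$⟩ʳ i ⌝

PermPoint : ∀ {N} → Pred (Point N) 0ℓ
PermPoint p = ∃[ σ ] p ≡ permPoint σ

-- ψ(v) = Σ i vᵢ, maximal at the identity permutation, which is therefore the
-- minimum of the weak Bruhat order.
weakBruhat : ∀ {N} → Point N
weakBruhat = tabulate ⌜_⌝

open +-*-Solver using (solve; _:=_; _:+_; _:*_; :-_; _:-_; con)

⌜⌝-mono : ∀ {N} {i j : Fin N} → i Fin.< j → ⌜ i ⌝ < ⌜ j ⌝
⌜⌝-mono i<j = ℚ.*<* (ℤ.*-monoʳ-<-pos (+ 1) (ℤ.+<+ (ℕ.s<s i<j)))

⌜⌝-cancel-< : ∀ {N} {i j : Fin N} → ⌜ i ⌝ < ⌜ j ⌝ → i Fin.< j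
⌜⌝-cancel-< {i = i} {j} lt with Fin.<-cmp i j
... | tri< i<j _ _  = i<j
... | tri≈ _ refl _ = contradiction lt (ℚ.<-irrefl refl)
... | tri> _ _ j<i  = contradiction lt (ℚ.<-asym (⌜⌝-mono j<i))

⌜⌝-injective : ∀ {N} {i j : Fin N} → ⌜ i ⌝ ≡ ⌜ j ⌝ → i ≡ j
⌜⌝-injective {i = i} {j} eq with Fin.<-cmp i j
... | tri< i<j _ _ = contradiction eq (ℚ.<⇒≢ (⌜⌝-mono i<j))
... | tri≈ _ i≡j _ = i≡j
... | tri> _ _ j<i = contradiction (sym eq) (ℚ.<⇒≢ (⌜⌝-mono j<i))

p-q≡0⇒p≡q : ∀ {p q} → p - q ≡ 0ℚ → p ≡ q
p-q≡0⇒p≡q {p} {q} eq =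
  trans (solve 2 (λ p q → p := (p :- q) :+ q) refl p q)
        (trans (cong (_+ q) eq) (ℚ.+-identityˡ q))

⌜⌝-distinct : ∀ {N} {i j : Fin N} → i ≢ j → ⌜ i ⌝ - ⌜ j ⌝ ≢ 0ℚ
⌜⌝-distinct {i = i} {j} i≢j eq = i≢j (⌜⌝-injective (p-q≡0⇒p≡q {⌜ i ⌝} {⌜ j ⌝} eq))

σ-injective : ∀ {N} (σ : Permutation′ N) {i j} → σ ⟨$⟩ʳ i ≡ σ ⟨$⟩ʳ j → i ≡ j
σ-injective σ eq = trans (sym (inverseˡ σ)) (trans (cong (σ ⟨$⟩ˡ_) eq) (inverseˡ σ))

vec-ext : ∀ {d} {p q : Point d} → (∀ i → lookup p i ≡ lookup q i) → p ≡ q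
vec-ext {p = p} {q} eq =
  trans (sym (Vec.tabulate∘lookup p)) (trans (Vec.tabulate-cong eq) (Vec.tabulate∘lookup q))

p<q⇒0<q-p : ∀ {p q} → p < q → 0ℚ < q - p
p<q⇒0<q-p {p} {q} p<q = subst (_< q - p) (ℚ.+-inverseʳ p) (ℚ.+-monoˡ-< (- p) p<q)

p≤q⇒0≤q-p : ∀ {p q} → p ≤ q → 0ℚ ≤ q - p
p≤q⇒0≤q-p {p} {q} p≤q = subst (_≤ q - p) (ℚ.+-inverseʳ p) (ℚ.+-monoˡ-≤ (- p) p≤q)

0<product : ∀ {p q r s} → p < q → r < s → 0ℚ < (q - p) * (s - r)
0<product {p} {q} {r} {s} p<q r<s = ℚ.positive⁻¹ ((q - p) * (s - r))
  {{ℚ.pos*pos⇒pos (q - p) {{ℚ.positive (p<q⇒0<q-p p<q)}} (s - r) {{ℚ.positive (p<q⇒0<q-p r<s)}}}}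

<-+ : ∀ {s g t} → t ≡ s + g → 0ℚ < g → s < t
<-+ {s} {g} {t} eq 0<g = subst₂ _<_ (ℚ.+-identityʳ s) (sym eq) (ℚ.+-monoʳ-< s 0<g)

<-≤-absurd : ∀ {p q} {A : Set} → p < q → q ≤ p → A
<-≤-absurd p<q q≤p = contradiction (ℚ.<-≤-trans p<q q≤p) (ℚ.<-irrefl refl)

*-zero-cancel : ∀ {p q} → q ≢ 0ℚ → p * q ≡ 0ℚ → p ≡ 0ℚ
*-zero-cancel {p} {q} q≢0 eq = begin
  p                ≡⟨ ℚ.*-identityʳ p ⟨
  p * 1ℚ           ≡⟨ cong (p *_) (ℚ.*-inverseʳ q) ⟨
  p * (q * 1/ q)   ≡⟨ ℚ.*-assoc p q (1/ q) ⟨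
  p * q * 1/ q     ≡⟨ cong (_* 1/ q) eq ⟩
  0ℚ * 1/ q        ≡⟨ ℚ.*-zeroˡ (1/ q) ⟩
  0ℚ               ∎
  where
  open ≡-Reasoning
  instance _ = ℚ.≢-nonZero q≢0

δ : ∀ {N} → Fin N → Fin N → ℚ
δ i l = if does (l Fin.≟ i) then 1ℚ else 0ℚ

sum-zero : ∀ n → ∑[ i < n ] 0ℚ ≡ 0ℚ
sum-zero = sum-replicate-zero

sum-δ : ∀ {N} (f : Fin N → ℚ) i → ∑[ l < N ] (f l * δ i l) ≡ f i
sum-δ {suc N} f zero = begin
  f zero * 1ℚ + ∑[ l < N ] (f (suc l) * 0ℚ)
    ≡⟨ cong₂ _+_ (ℚ.*-identityʳ (f zero)) (sum-cong-≗ {N} λ l → ℚ.*-zeroʳ (f (suc l))) ⟩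
  f zero + ∑[ l < N ] 0ℚ
    ≡⟨ cong (_+_ (f zero)) (sum-zero N) ⟩
  f zero + 0ℚ
    ≡⟨ ℚ.+-identityʳ _ ⟩
  f zero ∎
  where open ≡-Reasoning
sum-δ {suc N} f (suc i) = begin
  f zero * 0ℚ + ∑[ l < N ] (f (suc l) * δ i l)
    ≡⟨ cong₂ _+_ (ℚ.*-zeroʳ (f zero)) (sum-δ (f ∘ suc) i) ⟩
  0ℚ + f (suc i)
    ≡⟨ ℚ.+-identityˡ _ ⟩
  f (suc i) ∎
  where open ≡-Reasoning

sum-δ′ : ∀ {N} (f : Fin N → ℚ) i → ∑[ l < N ] (f l * δ l i) ≡ f i
sum-δ′ f i = trans (sum-cong-≗ λ l → cong (f l *_) (δ-sym l i)) (sum-δ f i)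
  where
  δ-sym : ∀ {N} (l i : Fin N) → δ l i ≡ δ i l
  δ-sym l i with l Fin.≟ i
  ... | yes refl rewrite dec-true (l Fin.≟ l) refl = refl
  ... | no l≢i rewrite dec-false (i Fin.≟ l) (l≢i ∘ sym) = refl

sum-nonneg : ∀ {n} (f : Fin n → ℚ) → (∀ i → 0ℚ ≤ f i) → 0ℚ ≤ sum f
sum-nonneg {zero}  f f≥0 = ℚ.≤-refl
sum-nonneg {suc n} f f≥0 = ℚ.+-mono-≤ (f≥0 zero) (sum-nonneg (f ∘ suc) (f≥0 ∘ suc))

sum-nonneg-zero : ∀ {n} (f : Fin n → ℚ) → (∀ i → 0ℚ ≤ f i) → sum f ≡ 0ℚ → ∀ i → f i ≡ 0ℚ
sum-nonneg-zero {suc n} f f≥0 Σ≡0 = λ where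
    zero    → f0≡0
    (suc i) → sum-nonneg-zero (f ∘ suc) (f≥0 ∘ suc) rest≡0 i
  where
  rest≥0 = sum-nonneg (f ∘ suc) (f≥0 ∘ suc)
  f0≡0 : f zero ≡ 0ℚ
  f0≡0 = ℚ.≤-antisym
    (ℚ.≤-trans (ℚ.≤-reflexive (sym (ℚ.+-identityʳ _)))
      (ℚ.≤-trans (ℚ.+-monoʳ-≤ (f zero) rest≥0) (ℚ.≤-reflexive Σ≡0)))
    (f≥0 zero)
  rest≡0 : sum (f ∘ suc) ≡ 0ℚ
  rest≡0 = trans (sym (ℚ.+-identityˡ _)) (trans (cong (_+ sum (f ∘ suc)) (sym f0≡0)) Σ≡0)

lookup-combine : ∀ {d m} (w : Fin m → ℚ) (v : Fin m → Point d) j →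
                 lookup (combine w v) j ≡ ∑[ i < m ] (w i * lookup (v i) j)
lookup-combine w v j = Vec.lookup∘tabulate _ j

·-combine : ∀ {d m} (c : Point d) (w : Fin m → ℚ) (v : Fin m → Point d) →
            c · combine w v ≡ ∑[ i < m ] (w i * c · v i)
·-combine {d} {m} c w v = begin
  ∑[ j < d ] (lookup c j * lookup (combine w v) j)
    ≡⟨ sum-cong-≗ {d} (λ j → trans (cong (lookup c j *_) (lookup-combine w v j))
                               (*-distribˡ-sum (lookup c j) (λ i → w i * lookup (v i) j))) ⟩
  ∑[ j < d ] ∑[ i < m ] (lookup c j * (w i * lookup (v i) j))
    ≡⟨ ∑-comm (λ j i → lookup c j * (w i * lookup (v i) j)) ⟩
  ∑[ i < m ] ∑[ j < d ] (lookup c j * (w i * lookup (v i) j))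
    ≡⟨ sum-cong-≗ {m} (λ i → trans
         (sum-cong-≗ {d} λ j → solve 3 (λ a b c → a :* (b :* c) := b :* (a :* c)) refl
                                 (lookup c j) (w i) (lookup (v i) j))
         (sym (*-distribˡ-sum (w i) (λ j → lookup c j * lookup (v i) j)))) ⟩
  ∑[ i < m ] (w i * c · v i) ∎
  where open ≡-Reasoning

singleton : ∀ {d} {S : Pred (Point d) 0ℓ} {p} → S p → ConvexHull S p
singleton {p = p} Sp = record
  { size        = 1
  ; weights     = λ _ → 1ℚ
  ; points      = λ _ → p
  ; points∈S    = λ _ → Sp
  ; weights≥0   = λ _ → ℚ.toℚᵘ-cancel-≤ (ℚᵘ.*≤* (ℤ.+≤+ ℕ.z≤n))
  ; weights-sum = refl
  ; combination = vec-ext λ j → sym (trans (lookup-combine {m = 1} (λ _ → 1ℚ) (λ _ → p) j)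
                    (trans (ℚ.+-identityʳ (1ℚ * lookup p j)) (ℚ.*-identityˡ (lookup p j))))
  }

-- Generators occurring with positive weight in a point of a face lie in that face.
module _ {d} {S : Pred (Point d) 0ℓ} {c p : Point d} (p∈F : Maximizers (ConvexHull S) c p) where
  open ConvexHull (member p∈F)

  private
    M = c · p

    gap : Fin size → ℚ
    gap i = weights i * (M - c · points i)

    gap≥0 : ∀ i → 0ℚ ≤ gap i
    gap≥0 i = subst (_≤ gap i) (ℚ.*-zeroʳ (weights i))
      (ℚ.*-monoˡ-≤-nonNeg (weights i) {{ℚ.nonNegative (weights≥0 i)}}
        (p≤q⇒0≤q-p (maximal p∈F (singleton (points∈S i)))))

    gap-sum : sum gap ≡ 0ℚ
    gap-sum = begin
      ∑[ i < size ] (weights i * (M - c · points i))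
        ≡⟨ sum-cong-≗ {size} (λ i → solve 3 (λ w M x → w :* (M :- x) := w :* M :+ :- con 1ℚ :* (w :* x)) refl
                                (weights i) M (c · points i)) ⟩
      ∑[ i < size ] (weights i * M + (- 1ℚ) * (weights i * c · points i))
        ≡⟨ ∑-distrib-+ {size} (λ i → weights i * M) (λ i → (- 1ℚ) * (weights i * c · points i)) ⟩
      ∑[ i < size ] (weights i * M) + ∑[ i < size ] ((- 1ℚ) * (weights i * c · points i))
        ≡⟨ cong₂ _+_ (*-distribʳ-sum M weights)
                     (*-distribˡ-sum (- 1ℚ) (λ i → weights i * c · points i)) ⟨
      sum weights * M + (- 1ℚ) * ∑[ i < size ] (weights i * c · points i)
        ≡⟨ cong₂ (λ a b → a * M + (- 1ℚ) * b) weights-sum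
             (trans (sym (·-combine c weights points)) (cong (c ·_) (sym combination))) ⟩
      1ℚ * M + (- 1ℚ) * M
        ≡⟨ solve 1 (λ M → con 1ℚ :* M :+ :- con 1ℚ :* M := con 0ℚ) refl M ⟩
      0ℚ ∎
      where open ≡-Reasoning

  support∈F : ∀ i → weights i ≢ 0ℚ → Maximizers (ConvexHull S) c (points i)
  support∈F i w≢0 = singleton (points∈S i) , λ {q} q∈P → ℚ.≤-trans (maximal p∈F q∈P) (ℚ.≤-reflexive M≡)
    where
    M≡ : M ≡ c · points i
    M≡ = p-q≡0⇒p≡q (*-zero-cancel w≢0
           (trans (ℚ.*-comm _ (weights i)) (sum-nonneg-zero gap gap≥0 gap-sum i)))

  private
    support : ∀ {n} (w : Fin n → ℚ) → sum w ≡ 1ℚ → ∃[ i ] w i ≢ 0ℚ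
    support {suc n} w Σ≡1 with w zero ℚ.≟ 0ℚ
    ... | no w≢0 = zero , w≢0
    ... | yes w≡0 with support (w ∘ suc)
                         (trans (sym (ℚ.+-identityˡ _)) (trans (cong (_+ sum (w ∘ suc)) (sym w≡0)) Σ≡1))
    ...   | i , wi≢0 = suc i , wi≢0

  generator∈F : ∃[ s ] S s × Maximizers (ConvexHull S) c s
  generator∈F with support weights weights-sum
  ... | i , w≢0 = points i , points∈S i , support∈F i w≢0

  unique-generator : ∀ {s} → (∀ {t} → S t → Maximizers (ConvexHull S) c t → t ≡ s) → p ≡ s
  unique-generator {s} uniq = vec-ext λ j → begin
    lookup p j
      ≡⟨ cong (λ x → lookup x j) combination ⟩
    lookup (combine weights points) j
      ≡⟨ lookup-combine weights points j ⟩
    ∑[ i < size ] (weights i * lookup (points i) j)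
      ≡⟨ sum-cong-≗ {size} (λ i → term i j) ⟩
    ∑[ i < size ] (weights i * lookup s j)
      ≡⟨ *-distribʳ-sum (lookup s j) weights ⟨
    sum weights * lookup s j
      ≡⟨ cong (_* lookup s j) weights-sum ⟩
    1ℚ * lookup s j
      ≡⟨ ℚ.*-identityˡ _ ⟩
    lookup s j ∎
    where
    open ≡-Reasoning
    term : ∀ i j → weights i * lookup (points i) j ≡ weights i * lookup s j
    term i j with weights i ℚ.≟ 0ℚ
    ... | yes w≡0 rewrite w≡0 = trans (ℚ.*-zeroˡ (lookup (points i) j)) (sym (ℚ.*-zeroˡ (lookup s j)))
    ... | no  w≢0 = cong (λ x → weights i * lookup x j) (uniq (points∈S i) (support∈F i w≢0))

swap : ∀ {N} → Fin N → Fin N → Permutation′ N → Permutation′ N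
swap i j σ = transpose i j ∘ₚ σ

lookup-swap : ∀ {N} (σ : Permutation′ N) {i j} → i ≢ j → ∀ l →
              lookup (permPoint (swap i j σ)) l
              ≡ ⌜ σ ⟨$⟩ʳ l ⌝ + (⌜ σ ⟨$⟩ʳ j ⌝ - ⌜ σ ⟨$⟩ʳ i ⌝) * (δ i l - δ j l)
lookup-swap σ {i} {j} i≢j l = trans (Vec.lookup∘tabulate _ l) (lemma l)
  where
  lemma : ∀ l → ⌜ swap i j σ ⟨$⟩ʳ l ⌝
                ≡ ⌜ σ ⟨$⟩ʳ l ⌝ + (⌜ σ ⟨$⟩ʳ j ⌝ - ⌜ σ ⟨$⟩ʳ i ⌝) * (δ i l - δ j l)
  lemma l with l Fin.≟ i
  ... | yes refl rewrite dec-false (l Fin.≟ j) i≢j =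
          solve 2 (λ a b → b := a :+ (b :- a) :* (con 1ℚ :- con 0ℚ)) refl ⌜ σ ⟨$⟩ʳ l ⌝ ⌜ σ ⟨$⟩ʳ j ⌝
  ... | no _ with l Fin.≟ j
  ...   | yes refl =
          solve 2 (λ a b → b := a :+ (a :- b) :* (con 0ℚ :- con 1ℚ)) refl ⌜ σ ⟨$⟩ʳ l ⌝ ⌜ σ ⟨$⟩ʳ i ⌝
  ...   | no _ =
          solve 2 (λ a b → a := a :+ b :* (con 0ℚ :- con 0ℚ)) refl
            ⌜ σ ⟨$⟩ʳ l ⌝ (⌜ σ ⟨$⟩ʳ j ⌝ - ⌜ σ ⟨$⟩ʳ i ⌝)

·-swap : ∀ {N} (c : Point N) (σ : Permutation′ N) {i j} → i ≢ j →
         c · permPoint (swap i j σ)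
         ≡ c · permPoint σ + (⌜ σ ⟨$⟩ʳ j ⌝ - ⌜ σ ⟨$⟩ʳ i ⌝) * (lookup c i - lookup c j)
·-swap {N} c σ {i} {j} i≢j = begin
  ∑[ l < N ] (lookup c l * lookup (permPoint (swap i j σ)) l)
    ≡⟨ sum-cong-≗ {N} (λ l → trans (cong (lookup c l *_) (lookup-swap σ i≢j l))
         (solve 5 (λ c s d x y → c :* (s :+ d :* (x :- y)) :=
                                 c :* s :+ (d :* (c :* x) :+ (:- d) :* (c :* y))) refl
            (lookup c l) ⌜ σ ⟨$⟩ʳ l ⌝ d (δ i l) (δ j l))) ⟩
  ∑[ l < N ] (lookup c l * ⌜ σ ⟨$⟩ʳ l ⌝ + (d * (lookup c l * δ i l) + (- d) * (lookup c l * δ j l)))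
    ≡⟨ trans (∑-distrib-+ {N} (λ l → lookup c l * ⌜ σ ⟨$⟩ʳ l ⌝) (λ l → d * (lookup c l * δ i l) + (- d) * (lookup c l * δ j l)))
         (cong (_+_ (∑[ l < N ] (lookup c l * ⌜ σ ⟨$⟩ʳ l ⌝)))
           (∑-distrib-+ {N} (λ l → d * (lookup c l * δ i l)) (λ l → (- d) * (lookup c l * δ j l)))) ⟩
  ∑[ l < N ] (lookup c l * ⌜ σ ⟨$⟩ʳ l ⌝) +
    (∑[ l < N ] (d * (lookup c l * δ i l)) + ∑[ l < N ] ((- d) * (lookup c l * δ j l)))
    ≡⟨ cong₂ _+_
         (sum-cong-≗ {N} λ l → cong (lookup c l *_) (sym (Vec.lookup∘tabulate _ l)))
         (cong₂ _+_
           (trans (sym (*-distribˡ-sum {N} d (λ l → lookup c l * δ i l))) (cong (d *_) (sum-δ (lookup c) i)))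
           (trans (sym (*-distribˡ-sum {N} (- d) (λ l → lookup c l * δ j l))) (cong ((- d) *_) (sum-δ (lookup c) j)))) ⟩
  c · permPoint σ + (d * lookup c i + (- d) * lookup c j)
    ≡⟨ cong (_+_ (c · permPoint σ)) (solve 3 (λ d a b → d :* a :+ (:- d) :* b := d :* (a :- b)) refl
                       d (lookup c i) (lookup c j)) ⟩
  c · permPoint σ + d * (lookup c i - lookup c j) ∎
  where
  open ≡-Reasoning
  d = ⌜ σ ⟨$⟩ʳ j ⌝ - ⌜ σ ⟨$⟩ʳ i ⌝

perm∈P : ∀ {N} (σ : Permutation′ N) → ConvexHull PermPoint (permPoint σ)
perm∈P σ = singleton (σ , refl)

maximizer-monotone : ∀ {N} {c : Point N} (σ : Permutation′ N) →
  Maximizers (ConvexHull PermPoint) c (permPoint σ) →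
  ∀ {i j} → lookup c i < lookup c j → (σ ⟨$⟩ʳ i) Fin.< (σ ⟨$⟩ʳ j)
maximizer-monotone {c = c} σ (_ , max) {i} {j} ci<cj with Fin.<-cmp (σ ⟨$⟩ʳ i) (σ ⟨$⟩ʳ j)
... | tri< lt _ _ = lt
... | tri≈ _ eq _ = contradiction (cong (lookup c) (σ-injective σ eq)) (ℚ.<⇒≢ ci<cj)
... | tri> _ _ gt = <-≤-absurd bigger (max (perm∈P (swap j i σ)))
  where
  j≢i : j ≢ i
  j≢i refl = ℚ.<-irrefl refl ci<cj
  gain = (⌜ σ ⟨$⟩ʳ i ⌝ - ⌜ σ ⟨$⟩ʳ j ⌝) * (lookup c j - lookup c i)
  gain>0 : 0ℚ < gain
  gain>0 = 0<product (⌜⌝-mono gt) ci<cj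
  bigger : c · permPoint σ < c · permPoint (swap j i σ)
  bigger = <-+ (·-swap c σ j≢i) gain>0

increasing⇒≤ : ∀ {N} (f : Fin N → Fin N) → (∀ {a b} → a Fin.< b → f a Fin.< f b) →
               ∀ a → a Fin.≤ f a
increasing⇒≤ {suc N} f f-mono = Fin.<-weakInduction (λ a → a Fin.≤ f a) ℕ.z≤n
  λ i i≤fi → ℕ.≤-trans
    (ℕ.s≤s (subst (ℕ._≤ toℕ (f (inject₁ i))) (Fin.toℕ-inject₁ i) i≤fi))
    (f-mono (ℕ.s≤s (ℕ.≤-reflexive (Fin.toℕ-inject₁ i))))

module _ {N} {c : Point N} (c-injective : ∀ {i j} → lookup c i ≡ lookup c j → i ≡ j) where

  private
    _∈F : Permutation′ N → Set
    σ ∈F = Maximizers (ConvexHull PermPoint) c (permPoint σ)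

    compare-mono : ∀ σ τ → σ ∈F → τ ∈F → ∀ {a b} → a Fin.< b →
                   (σ ⟨$⟩ʳ (τ ⟨$⟩ˡ a)) Fin.< (σ ⟨$⟩ʳ (τ ⟨$⟩ˡ b))
    compare-mono σ τ σ∈F τ∈F {a} {b} a<b
      with ℚ.<-cmp (lookup c (τ ⟨$⟩ˡ a)) (lookup c (τ ⟨$⟩ˡ b))
    ... | tri< lt _ _ = maximizer-monotone {c = c} σ σ∈F lt
    ... | tri≈ _ eq _ = contradiction a<b
          (Fin.<-irrefl (trans (sym (inverseʳ τ)) (trans (cong (τ ⟨$⟩ʳ_) (c-injective eq)) (inverseʳ τ))))
    ... | tri> _ _ gt = contradiction
          (subst₂ Fin._<_ (inverseʳ τ) (inverseʳ τ) (maximizer-monotone {c = c} τ τ∈F gt))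
          (Fin.<-asym a<b)

    compare-≤ : ∀ σ τ → σ ∈F → τ ∈F → ∀ i → (τ ⟨$⟩ʳ i) Fin.≤ (σ ⟨$⟩ʳ i)
    compare-≤ σ τ σ∈F τ∈F i = subst (λ x → (τ ⟨$⟩ʳ i) Fin.≤ (σ ⟨$⟩ʳ x)) (inverseˡ τ)
      (increasing⇒≤ _ (compare-mono σ τ σ∈F τ∈F) (τ ⟨$⟩ʳ i))

  unique-maximizer : ∀ σ τ → σ ∈F → τ ∈F → permPoint σ ≡ permPoint τ
  unique-maximizer σ τ σ∈F τ∈F = Vec.tabulate-cong λ i → cong ⌜_⌝
    (Fin.≤-antisym (compare-≤ τ σ τ∈F σ∈F i) (compare-≤ σ τ σ∈F τ∈F i))

swap-maximizer : ∀ {N} {c : Point N} (σ : Permutation′ N) {i j} → i ≢ j →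
  lookup c i ≡ lookup c j → Maximizers (ConvexHull PermPoint) c (permPoint σ) →
  Maximizers (ConvexHull PermPoint) c (permPoint (swap i j σ))
swap-maximizer {c = c} σ {i} {j} i≢j ci≡cj (_ , max) =
  perm∈P (swap i j σ) , λ {q} q∈P → ℚ.≤-trans (max q∈P) (ℚ.≤-reflexive (sym same))
  where
  same : c · permPoint (swap i j σ) ≡ c · permPoint σ
  same = trans (·-swap c σ i≢j) (trans
    (cong (λ x → c · permPoint σ + (⌜ σ ⟨$⟩ʳ j ⌝ - ⌜ σ ⟨$⟩ʳ i ⌝) * (x - lookup c j)) ci≡cj)
    (solve 3 (λ s d x → s :+ d :* (x :- x) := s) refl
      (c · permPoint σ) (⌜ σ ⟨$⟩ʳ j ⌝ - ⌜ σ ⟨$⟩ʳ i ⌝) (lookup c j)))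

swap-level : ∀ {N} (c : Point N) (σ : Permutation′ N) {i j} → i ≢ j →
             c · permPoint (swap i j σ) ≡ c · permPoint σ → lookup c i ≡ lookup c j
swap-level c σ {i} {j} i≢j same = p-q≡0⇒p≡q (*-zero-cancel {lookup c i - lookup c j} d≢0
  (trans (ℚ.*-comm (lookup c i - lookup c j) (⌜ σ ⟨$⟩ʳ j ⌝ - ⌜ σ ⟨$⟩ʳ i ⌝))
         (no-gain (·-swap c σ i≢j) same)))
  where
  no-gain : ∀ {s g t} → t ≡ s + g → t ≡ s → g ≡ 0ℚ
  no-gain {s} {g} {t} t≡s+g t≡s = begin
    g            ≡⟨ solve 2 (λ s g → g := (s :+ g) :- s) refl s g ⟩
    (s + g) - s  ≡⟨ cong (_- s) (trans (sym t≡s+g) t≡s) ⟩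
    s - s        ≡⟨ ℚ.+-inverseʳ s ⟩
    0ℚ           ∎
    where open ≡-Reasoning
  d≢0 : ⌜ σ ⟨$⟩ʳ j ⌝ - ⌜ σ ⟨$⟩ʳ i ⌝ ≢ 0ℚ
  d≢0 = ⌜⌝-distinct λ eq → i≢j (sym (σ-injective σ eq))

edge-points-distinct : ∀ {d} {S : Pred (Point d) 0ℓ} → HasDim S 1 →
                       ∃[ p ] ∃[ q ] S p × S q × p ≢ q
edge-points-distinct {d} dim1 =
  basis zero , basis (suc zero) , basis∈S zero , basis∈S (suc zero) , λ eq →
    contradiction (independent w refl (zero-combination eq) zero) λ ()
  where
  open HasDim dim1
  w : Fin 2 → ℚ
  w zero    = 1ℚ
  w (suc _) = - 1ℚ
  zero-combination : basis zero ≡ basis (suc zero) → combine w basis ≡ replicate d 0ℚ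
  zero-combination eq = vec-ext λ j → begin
    lookup (combine w basis) j
      ≡⟨ lookup-combine w basis j ⟩
    1ℚ * lookup (basis zero) j + ((- 1ℚ) * lookup (basis (suc zero)) j + 0ℚ)
      ≡⟨ cong (λ x → 1ℚ * lookup x j + ((- 1ℚ) * lookup (basis (suc zero)) j + 0ℚ)) eq ⟩
    1ℚ * lookup (basis (suc zero)) j + ((- 1ℚ) * lookup (basis (suc zero)) j + 0ℚ)
      ≡⟨ solve 1 (λ x → con 1ℚ :* x :+ (:- con 1ℚ :* x :+ con 0ℚ) := con 0ℚ) refl
           (lookup (basis (suc zero)) j) ⟩
    0ℚ
      ≡⟨ Vec.lookup-replicate j 0ℚ ⟨
    lookup (replicate d 0ℚ) j ∎
    where open ≡-Reasoning

constant⇒injective : ∀ {N} {c : Point N} (σ : Permutation′ N) →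
  Maximizers (ConvexHull PermPoint) c (permPoint σ) →
  ConstantOn weakBruhat (Maximizers (ConvexHull PermPoint) c) →
  ∀ i j → lookup c i ≡ lookup c j → i ≡ j
constant⇒injective {N} {c} σ σ∈F const i j ci≡cj with i Fin.≟ j
... | yes i≡j = i≡j
... | no  i≢j = ⌜⌝-injective (trans (sym (Vec.lookup∘tabulate ⌜_⌝ i)) (trans
      (swap-level weakBruhat σ i≢j
        (const {permPoint (swap i j σ)} {permPoint σ} (swap-maximizer σ i≢j ci≡cj σ∈F) σ∈F))
      (Vec.lookup∘tabulate ⌜_⌝ j)))

constant⇒singleton : ∀ {N} {c : Point N} (σ : Permutation′ N) →
  Maximizers (ConvexHull PermPoint) c (permPoint σ) →
  ConstantOn weakBruhat (Maximizers (ConvexHull PermPoint) c) →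
  ∀ {r} → Maximizers (ConvexHull PermPoint) c r → r ≡ permPoint σ
constant⇒singleton {N} {c} σ σ∈F const r∈F = unique-generator r∈F uniq
  where
  uniq : ∀ {t} → PermPoint t → Maximizers (ConvexHull PermPoint) c t → t ≡ permPoint σ
  uniq (τ , refl) τ∈F =
    unique-maximizer (λ {i} {j} → constant⇒injective σ σ∈F const i j) τ σ τ∈F σ∈F

weakBruhat-nonconstant : ∀ {N} {c : Point N} → HasDim (Maximizers (ConvexHull PermPoint) c) 1 →
                         ¬ ConstantOn weakBruhat (Maximizers (ConvexHull PermPoint) c)
weakBruhat-nonconstant {N} {c} dim1 const = go (edge-points-distinct dim1)
  where
  go : ∃[ p ] ∃[ q ] Maximizers (ConvexHull PermPoint) c p × Maximizers (ConvexHull PermPoint) c q × p ≢ q → ⊥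
  go (p , q , p∈F , q∈F , p≢q) = from-generator (generator∈F p∈F)
    where
    from-generator : ∃[ s ] PermPoint s × Maximizers (ConvexHull PermPoint) c s → ⊥
    from-generator (_ , (σ , refl) , σ∈F) = p≢q (trans
      (constant⇒singleton σ σ∈F const p∈F) (sym (constant⇒singleton σ σ∈F const q∈F)))

allVecs : ∀ {A : Set} → List A → ∀ m → List (Vec A m)
allVecs xs zero    = List.[ [] ]
allVecs xs (suc m) = List.cartesianProductWith _∷_ xs (allVecs xs m)

∈-allVecs : ∀ {A : Set} {xs : List A} → (∀ x → x ∈ xs) → ∀ {m} (v : Vec A m) → v ∈ allVecs xs m
∈-allVecs all∈ []      = here refl
∈-allVecs all∈ (x ∷ v) = ∈-cartesianProductWith⁺ _∷_ (all∈ x) (∈-allVecs all∈ v)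

PermPoint-finite : ∀ {N} → ∃[ xs ] (∀ {p : Point N} → PermPoint p → p ∈ xs)
PermPoint-finite {N} = List.map (Vec.map ⌜_⌝) (allVecs (List.allFin N) N) , λ where
  (σ , refl) → subst (_∈ _) (sym (Vec.tabulate-∘ ⌜_⌝ (σ ⟨$⟩ʳ_)))
                 (∈-map⁺ (Vec.map ⌜_⌝) (∈-allVecs ∈-allFin (tabulate (σ ⟨$⟩ʳ_))))

module Dimension (n : ℕ) where
  N = suc n

  total : ℚ
  total = ∑[ l < N ] ⌜ l ⌝

  total-perm : ∀ {p} → PermPoint p → ∑[ l < N ] lookup p l ≡ total
  total-perm (σ , refl) = trans (sum-cong-≗ {N} λ l → Vec.lookup∘tabulate (λ i → ⌜ σ ⟨$⟩ʳ i ⌝) l)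
                                (sym (sum-permute (λ l → ⌜ l ⌝) σ))

  total-combine : ∀ {m} (w : Fin m → ℚ) (v : Fin m → Point N) → (∀ i → PermPoint (v i)) →
                  sum w ≡ 1ℚ → ∑[ l < N ] lookup (combine w v) l ≡ total
  total-combine {m} w v v∈S Σw≡1 = begin
    ∑[ l < N ] lookup (combine w v) l
      ≡⟨ sum-cong-≗ {N} (lookup-combine w v) ⟩
    ∑[ l < N ] ∑[ i < m ] (w i * lookup (v i) l)
      ≡⟨ ∑-comm (λ l i → w i * lookup (v i) l) ⟩
    ∑[ i < m ] ∑[ l < N ] (w i * lookup (v i) l)
      ≡⟨ sum-cong-≗ {m} (λ i → trans (sym (*-distribˡ-sum (w i) (lookup (v i))))
                                     (cong (w i *_) (total-perm (v∈S i)))) ⟩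
    ∑[ i < m ] (w i * total)
      ≡⟨ *-distribʳ-sum total w ⟨
    sum w * total
      ≡⟨ cong (_* total) Σw≡1 ⟩
    1ℚ * total
      ≡⟨ ℚ.*-identityˡ total ⟩
    total ∎
    where open ≡-Reasoning

  basis-perm : Fin N → Permutation′ N
  basis-perm zero    = idₚ
  basis-perm (suc i) = swap zero (suc i) idₚ

  basis : Fin N → Point N
  basis i = permPoint (basis-perm i)

  a : Fin n → ℚ
  a i = ⌜ Fin.suc i ⌝ - ⌜ zero {n} ⌝

  a≢0 : ∀ i → a i ≢ 0ℚ
  a≢0 i = ⌜⌝-distinct {i = suc i} {zero} λ ()

  lookup-basis : ∀ w m → lookup (combine w basis) (suc m)
                       ≡ sum w * ⌜ Fin.suc m ⌝ - w (suc m) * a m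
  lookup-basis w m = begin
    lookup (combine w basis) (suc m)
      ≡⟨ lookup-combine w basis (suc m) ⟩
    w zero * lookup (basis zero) (suc m) + ∑[ i < n ] (w (suc i) * lookup (basis (suc i)) (suc m))
      ≡⟨ cong₂ (λ x y → w zero * x + y) (Vec.lookup∘tabulate ⌜_⌝ (suc m))
           (sum-cong-≗ {n} λ i → trans
             (cong (w (suc i) *_) (lookup-swap idₚ {zero} {suc i} (λ ()) (suc m)))
             (solve 4 (λ w s a d → w :* (s :+ a :* (con 0ℚ :- d)) := w :* s :+ (:- con 1ℚ) :* ((w :* a) :* d))
                refl (w (suc i)) s (a i) (δ i m))) ⟩
    w zero * s + ∑[ i < n ] (w (suc i) * s + (- 1ℚ) * ((w (suc i) * a i) * δ i m))
      ≡⟨ cong (_+_ (w zero * s)) (trans (∑-distrib-+ {n} (λ i → w (suc i) * s) (λ i → (- 1ℚ) * ((w (suc i) * a i) * δ i m)))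
           (cong₂ _+_ (sym (*-distribʳ-sum s (w ∘ suc)))
             (trans (sym (*-distribˡ-sum {n} (- 1ℚ) (λ i → (w (suc i) * a i) * δ i m)))
                    (cong ((- 1ℚ) *_) (sum-δ′ (λ i → w (suc i) * a i) m))))) ⟩
    w zero * s + (sum (w ∘ suc) * s + (- 1ℚ) * (w (suc m) * a m))
      ≡⟨ solve 4 (λ w s r x → w :* s :+ (r :* s :+ (:- con 1ℚ) :* x) := (w :+ r) :* s :- x) refl
           (w zero) s (sum (w ∘ suc)) (w (suc m) * a m) ⟩
    sum w * s - w (suc m) * a m ∎
    where
    open ≡-Reasoning
    s = ⌜ Fin.suc m ⌝

  basis-independent : AffinelyIndependent basis
  basis-independent w Σw≡0 comb≡0 = λ where
      zero    → trans (sym (ℚ.+-identityʳ _)) (trans (cong (_+_ (w zero)) (sym rest≡0)) Σw≡0)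
      (suc m) → tail≡0 m
    where
    open ≡-Reasoning
    tail≡0 : ∀ m → w (suc m) ≡ 0ℚ
    tail≡0 m = *-zero-cancel (a≢0 m) (begin
      w (suc m) * a m
        ≡⟨ solve 2 (λ x s → x := :- (con 0ℚ :* s :- x)) refl (w (suc m) * a m) ⌜ Fin.suc m ⌝ ⟩
      - (0ℚ * ⌜ Fin.suc m ⌝ - w (suc m) * a m)
        ≡⟨ cong (λ x → - (x * ⌜ Fin.suc m ⌝ - w (suc m) * a m)) Σw≡0 ⟨
      - (sum w * ⌜ Fin.suc m ⌝ - w (suc m) * a m)
        ≡⟨ cong -_ (lookup-basis w m) ⟨
      - lookup (combine w basis) (suc m)
        ≡⟨ cong (λ x → - lookup x (suc m)) comb≡0 ⟩
      - lookup (replicate N 0ℚ) (suc m)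
        ≡⟨ cong -_ (Vec.lookup-replicate (suc m) 0ℚ) ⟩
      0ℚ ∎)
    rest≡0 : sum (w ∘ suc) ≡ 0ℚ
    rest≡0 = trans (sum-cong-≗ {n} tail≡0) (sum-zero n)

  basis-spanning : ∀ {p} → ConvexHull PermPoint p → ∃[ w ] sum w ≡ 1ℚ × p ≡ combine w basis
  basis-spanning {p} p∈P = w , Σw≡1 , vec-ext λ where
      zero    → head-agrees
      (suc m) → sym (tail-agrees m)
    where
    open ≡-Reasoning
    open ConvexHull p∈P
    inv : Fin n → ℚ
    inv m = (1/ a m) {{ℚ.≢-nonZero (a≢0 m)}}
    w′ : Fin n → ℚ
    w′ m = (⌜ Fin.suc m ⌝ - lookup p (suc m)) * inv m
    w : Fin N → ℚ
    w zero    = 1ℚ - sum w′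
    w (suc m) = w′ m
    Σw≡1 : sum w ≡ 1ℚ
    Σw≡1 = solve 1 (λ x → (con 1ℚ :- x) :+ x := con 1ℚ) refl (sum w′)
    tail-agrees : ∀ m → lookup (combine w basis) (suc m) ≡ lookup p (suc m)
    tail-agrees m = begin
      lookup (combine w basis) (suc m)
        ≡⟨ lookup-basis w m ⟩
      sum w * s - (s - x) * inv m * a m
        ≡⟨ cong₂ (λ t u → t * s - u) Σw≡1 (trans (ℚ.*-assoc (s - x) (inv m) (a m))
             (cong ((s - x) *_) (ℚ.*-inverseˡ (a m) {{ℚ.≢-nonZero (a≢0 m)}}))) ⟩
      1ℚ * s - (s - x) * 1ℚ
        ≡⟨ solve 2 (λ s x → con 1ℚ :* s :- (s :- x) :* con 1ℚ := x) refl s x ⟩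
      x ∎
      where
      s = ⌜ Fin.suc m ⌝
      x = lookup p (suc m)
    head-agrees : lookup p zero ≡ lookup (combine w basis) zero
    head-agrees = begin
      lookup p zero
        ≡⟨ solve 2 (λ x r → x := (x :+ r) :- r) refl (lookup p zero) _ ⟩
      ∑[ l < N ] lookup p l - ∑[ m < n ] lookup p (suc m)
        ≡⟨ cong₂ _-_
             (trans (trans (cong (λ q → ∑[ l < N ] lookup q l) combination)
                           (total-combine weights points points∈S weights-sum))
                    (sym (total-combine w basis (λ i → basis-perm i , refl) Σw≡1)))
             (sum-cong-≗ {n} (λ m → sym (tail-agrees m))) ⟩
      ∑[ l < N ] lookup (combine w basis) l - ∑[ m < n ] lookup (combine w basis) (suc m)
        ≡⟨ solve 2 (λ x r → x := (x :+ r) :- r) refl (lookup (combine w basis) zero)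
             (∑[ m < n ] lookup (combine w basis) (suc m)) ⟨
      lookup (combine w basis) zero ∎

  permutahedron-dim : HasDim (ConvexHull {N} PermPoint) n
  permutahedron-dim = record
    { basis       = basis
    ; basis∈S     = λ i → perm∈P (basis-perm i)
    ; independent = basis-independent
    ; spanning    = basis-spanning
    }

-- The permutahedron with N = n + 1, of dimension n.
permutahedron : ℕ → OrientedPolytope
permutahedron n = record
  { ambient     = suc n
  ; generator   = PermPoint
  ; finite      = PermPoint-finite
  ; dim         = n
  ; hasDim      = Dimension.permutahedron-dim n
  ; ψ           = weakBruhat
  ; nonconstant = λ E dimE≡1 → weakBruhat-nonconstant
                    (subst (HasDim _) dimE≡1 (Face.hasDim E))
  }

permutahedra : Family
permutahedra = record
  { polytopeOfDim = λ n → permutahedron n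
  ; dim-correct   = λ n → refl
  }

{-# OPTIONS --safe #-}
-- An ordered set partition is recorded by a level function on Fin N, the order
-- pattern of a normal vector c of the face; the face has dimension N minus the
-- number of levels, and F ≤ G means that every pair i < j is strictly ascending
-- in F or strictly descending in G.  Hence the minimum excess exists for k ≥ 2 by
-- a finite search over chains of level functions.
--
-- Every face has dimension at most n, so e_k ≥ E_k - k.  Conversely, write
-- i = x M + y and take the levels b x + (M - y) for b = k, …, 1.  These rotating
-- linear functionals form a face chain, and the b-th one has at most
-- b n / M + M + 1 levels, so e_k - E_k ≤ k (k n / M + M + 1) for every M, which is
-- an arbitrarily small fraction of E_k ~ (1 - k) n.  For k = 1 a facet has
-- excess 1 = E_1.
module Submission where

open import Defs
open import Algebra.Bundles using (CommutativeRing)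
import Algebra.Properties.Semiring.Sum as SemiringSum
open import Data.Bool.Base using (if_then_else_)
open import Data.Fin.Base as Fin using (Fin; zero; suc; toℕ; fromℕ<; punchIn; punchOut; splitAt; join)
open import Data.Fin.Permutation using (Permutation′; permutation; _⟨$⟩ʳ_; _⟨$⟩ˡ_; inverseˡ; inverseʳ)
  renaming (id to idₚ)
import Data.Fin.Properties as Fin
open import Data.Fin.Subset as Subset using (Subset)
import Data.Fin.Subset.Properties as Subset
open import Data.Integer.Base as ℤ using (ℤ; +_; +[1+_]; -[1+_])
import Data.Integer.Properties as ℤ
open import Data.Integer.Tactic.RingSolver using (solve-∀)
open import Data.List.Base as List using (List)
import Data.List.Extrema as Extrema
open import Data.List.Membership.Propositional.Properties using (∈-allFin; ∈-filter⁺)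
import Data.List.Relation.Unary.All as ListAll
import Data.List.Relation.Unary.All.Properties as ListAll
open import Data.Nat.Base as ℕ using (ℕ; zero; suc; NonZero)
import Data.Nat.Coprimality as Coprime
import Data.Nat.DivMod as ℕ
import Data.Nat.Properties as ℕ
import Data.Nat.Tactic.RingSolver as ℕ
open import Data.Product.Base using (Σ-syntax; ∃-syntax; _×_; _,_; proj₁; proj₂)
open import Data.Rational.Base as ℚ
  using (ℚ; 0ℚ; 1ℚ; _+_; _*_; _-_; -_; _≤_; _<_; ∣_∣; _/_; _÷_; 1/_)
import Data.Rational.Properties as ℚ
open import Data.Rational.Solver using (module +-*-Solver)
open import Data.Sum.Base using (_⊎_; inj₁; inj₂; [_,_]′)
open import Data.Sum.Properties using (inj₁-injective; inj₂-injective)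
open import Data.Vec.Base as Vec using (Vec; []; _∷_; lookup; tabulate; replicate)
import Data.Vec.Functional as Vector
import Data.Vec.Properties as Vec
open import Data.Vec.Relation.Unary.Linked as Linked using (Linked; []; [-]; _∷_)
import Data.Vec.Relation.Unary.Linked.Properties as Linked
open import Function.Base using (_∘_; case_of_)
open import Level using (0ℓ)
open import Relation.Binary.Construct.Closure.ReflexiveTransitive using (_◅_) renaming (ε to nil)
import Relation.Binary.Construct.Flip.EqAndOrd as Flip
open import Relation.Binary.Core using (Rel)
open import Relation.Binary.Definitions using (tri<; tri≈; tri>)
import Relation.Binary.Definitions as Binary
open import Relation.Binary.PropositionalEquality
open import Relation.Binary.Structures using (IsStrictTotalOrder)
open import Relation.Nullary using (¬_; Dec; yes; no; does; contradiction)
open import Relation.Nullary.Decidable using (dec-true; dec-false; ¬?; _×-dec_; _⊎-dec_; _→-dec_)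
open import Relation.Unary using (Pred; Decidable)
import Algebra.Properties.Group ℚ.+-0-group as +-group

open SemiringSum (CommutativeRing.semiring ℚ.+-*-commutativeRing)
open +-*-Solver using (solve; _:=_; _:+_; _:*_; :-_; _:-_; con)
open Face using (carrier)
open Maximizers

-- Linear algebra and convex hulls

-- The definitions are geometric, so the combinatorics of ordered partitions has to be derived from
-- them. For the dimension: on the face with normal c the coordinate sum over each level set of c is
-- constant, so the coordinates outside a transversal determine a point; swapping each such index
-- with its representative at one vertex gives an affine basis. For the order: an arrow may use any
-- one-dimensional face, and is not given as a swap of consecutive values. It suffices that
-- inversions persist along every arrow and that, conversely, bubble sort realises inclusion of
-- inversions by arrows. For the search: infinitely many normals give the same face, so normals are
-- first replaced by their rank patterns. For the fan: if i < j differ in x, the level of j minus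
-- that of i is b (x_j - x_i) - (y_j - y_i), strictly increasing in b; as b falls, the pair passes
-- from ascending to descending with at most one tie. The part M - y separates indices with equal x
-- at the cost of about M levels, while b x costs about b n / M, so a large fixed M makes the count
-- a small fraction of n.

sum-linear : ∀ {m} (f g w : Fin m → ℚ) t →
  ∑[ j < m ] ((f j + (- t) * g j) * w j) ≡ ∑[ j < m ] (f j * w j) + (- t) * ∑[ j < m ] (g j * w j)
sum-linear {m} f g w t = begin
  ∑[ j < m ] ((f j + (- t) * g j) * w j)
    ≡⟨ sum-cong-≗ {m} (λ j → solve 4 (λ f t g w → (f :+ (:- t) :* g) :* w := f :* w :+ (:- t) :* (g :* w))
         refl (f j) t (g j) (w j)) ⟩
  ∑[ j < m ] (f j * w j + (- t) * (g j * w j))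
    ≡⟨ ∑-distrib-+ {m} (λ j → f j * w j) (λ j → (- t) * (g j * w j)) ⟩
  ∑[ j < m ] (f j * w j) + ∑[ j < m ] ((- t) * (g j * w j))
    ≡⟨ cong (_+_ (∑[ j < m ] (f j * w j))) (sym (*-distribˡ-sum {m} (- t) (λ j → g j * w j))) ⟩
  ∑[ j < m ] (f j * w j) + (- t) * ∑[ j < m ] (g j * w j) ∎
  where open ≡-Reasoning

module _ {m} (A₀ : ℚ) (A₀≢0 : A₀ ≢ 0ℚ) (A : Fin m → ℚ) where
  private
    inv = (1/ A₀) {{ℚ.≢-nonZero A₀≢0}}

  back-substitute : (Fin m → ℚ) → ℚ
  back-substitute w = - (inv * ∑[ j < m ] (A j * w j))

  eliminate : ℚ → (Fin m → ℚ) → Fin m → ℚ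
  eliminate B₀ B j = B j + (- (B₀ * inv)) * A j

  back-substitute-pivot : ∀ w → A₀ * back-substitute w + ∑[ j < m ] (A j * w j) ≡ 0ℚ
  back-substitute-pivot w = cancel (∑[ j < m ] (A j * w j))
    where
    open ≡-Reasoning
    cancel : ∀ r → A₀ * - (inv * r) + r ≡ 0ℚ
    cancel r = begin
      A₀ * - (inv * r) + r  ≡⟨ solve 3 (λ x y r → x :* (:- (y :* r)) :+ r := (con 1ℚ :- x :* y) :* r) refl A₀ inv r ⟩
      (1ℚ - A₀ * inv) * r   ≡⟨ cong (λ x → (1ℚ - x) * r) (ℚ.*-inverseʳ A₀ {{ℚ.≢-nonZero A₀≢0}}) ⟩
      (1ℚ - 1ℚ) * r         ≡⟨ ℚ.*-zeroˡ r ⟩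
      0ℚ                    ∎

  back-substitute-other : ∀ w B₀ B → ∑[ j < m ] (eliminate B₀ B j * w j) ≡ 0ℚ →
                          B₀ * back-substitute w + ∑[ j < m ] (B j * w j) ≡ 0ℚ
  back-substitute-other w B₀ B eliminated = trans
    (rearrange (∑[ j < m ] (A j * w j)) (∑[ j < m ] (B j * w j)))
    (trans (sym (sum-linear {m} B A w (B₀ * inv))) eliminated)
    where
    rearrange : ∀ r s → B₀ * - (inv * r) + s ≡ s + (- (B₀ * inv)) * r
    rearrange r s = solve 4 (λ x y r s → x :* (:- (y :* r)) :+ s := s :+ (:- (x :* y)) :* r) refl B₀ inv r s

NontrivialSolution : ∀ {p m} → (Fin p → Fin m → ℚ) → Set
NontrivialSolution {p} {m} A = Σ[ w ∈ (Fin m → ℚ) ] (∃[ i ] w i ≢ 0ℚ) × (∀ a → ∑[ j < m ] (A a j * w j) ≡ 0ℚ)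

-- Gaussian elimination. If the first column vanishes, the first unit vector is a solution;
-- otherwise a nonzero entry serves as pivot, and eliminating with its row removes one equation and
-- one unknown.
nontrivial-solution : ∀ {p m} (A : Fin p → Fin m → ℚ) → p ℕ.< m → NontrivialSolution A
nontrivial-solution {p} {suc m} A p<m with Fin.any? (λ a → ¬? (A a zero ℚ.≟ 0ℚ))
... | no column≡0 = δ zero , (zero , λ ()) , λ a → trans (sum-δ (A a) zero) (column≡0′ a)
  where
  column≡0′ : ∀ a → A a zero ≡ 0ℚ
  column≡0′ a with A a zero ℚ.≟ 0ℚ
  ... | yes eq = eq
  ... | no neq = contradiction (a , neq) column≡0
nontrivial-solution {suc p} {suc m} A (ℕ.s≤s p<m) | yes (a , pivot≢0) =
  extend (nontrivial-solution A′ p<m)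
  where
  A′ : Fin p → Fin m → ℚ
  A′ b = eliminate (A a zero) pivot≢0 (A a ∘ suc) (A (punchIn a b) zero) (A (punchIn a b) ∘ suc)
  extend : NontrivialSolution A′ → NontrivialSolution A
  extend (w′ , (i , w′i≢0) , solves′) = w , (suc i , w′i≢0) , solves
    where
    w : Fin (suc m) → ℚ
    w zero    = back-substitute (A a zero) pivot≢0 (A a ∘ suc) w′
    w (suc j) = w′ j
    solves : ∀ b → ∑[ j < suc m ] (A b j * w j) ≡ 0ℚ
    solves b with a Fin.≟ b
    ... | yes refl = back-substitute-pivot (A a zero) pivot≢0 (A a ∘ suc) w′
    ... | no a≢b = subst (λ b → ∑[ j < suc m ] (A b j * w j) ≡ 0ℚ) (Fin.punchIn-punchOut a≢b)
          (back-substitute-other (A a zero) pivot≢0 (A a ∘ suc) w′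
            (A (punchIn a (punchOut a≢b)) zero) (A (punchIn a (punchOut a≢b)) ∘ suc) (solves′ (punchOut a≢b)))

sum-mono : ∀ {m} (f g : Fin m → ℚ) → (∀ i → f i ≤ g i) → sum f ≤ sum g
sum-mono {zero}  f g f≤g = ℚ.≤-refl
sum-mono {suc m} f g f≤g = ℚ.+-mono-≤ (f≤g zero) (sum-mono (f ∘ suc) (g ∘ suc) (f≤g ∘ suc))

sum-scale : ∀ {m} (w : Fin m → ℚ) → sum w ≡ 1ℚ → ∀ M → ∑[ i < m ] (w i * M) ≡ M
sum-scale w Σw≡1 M = trans (sym (*-distribʳ-sum M w)) (trans (cong (_* M) Σw≡1) (ℚ.*-identityˡ M))

hull-≤ : ∀ {d} {S : Pred (Point d) 0ℓ} (f : Point d) {M} → (∀ {s} → S s → f · s ≤ M) →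
         ∀ {p} → ConvexHull S p → f · p ≤ M
hull-≤ f {M} bound {p} p∈P = begin
  f · p                                    ≡⟨ cong (f ·_) combination ⟩
  f · combine weights points               ≡⟨ ·-combine f weights points ⟩
  ∑[ i < size ] (weights i * f · points i) ≤⟨ sum-mono _ _ (λ i → ℚ.*-monoˡ-≤-nonNeg (weights i)
                                                {{ℚ.nonNegative (weights≥0 i)}} (bound (points∈S i))) ⟩
  ∑[ i < size ] (weights i * M)            ≡⟨ sum-scale weights weights-sum M ⟩
  M                                        ∎
  where
  open ConvexHull p∈P
  open ℚ.≤-Reasoning

-- The values are prescribed only at points of nonzero weight, because those are the points that
-- `support∈F` places in a face.
hull-≡ : ∀ {d} {S : Pred (Point d) 0ℓ} (f : Point d) {M p} (p∈P : ConvexHull S p) →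
         (∀ i → ConvexHull.weights p∈P i ≢ 0ℚ → f · ConvexHull.points p∈P i ≡ M) → f · p ≡ M
hull-≡ f {M} {p} p∈P const = begin
  f · p                                    ≡⟨ cong (f ·_) combination ⟩
  f · combine weights points               ≡⟨ ·-combine f weights points ⟩
  ∑[ i < size ] (weights i * f · points i) ≡⟨ sum-cong-≗ {size} term ⟩
  ∑[ i < size ] (weights i * M)            ≡⟨ sum-scale weights weights-sum M ⟩
  M                                        ∎
  where
  open ConvexHull p∈P
  open ≡-Reasoning
  term : ∀ i → weights i * f · points i ≡ weights i * M
  term i with weights i ℚ.≟ 0ℚ
  ... | yes w≡0 rewrite w≡0 = trans (ℚ.*-zeroˡ (f · points i)) (sym (ℚ.*-zeroˡ M))
  ... | no  w≢0 = cong (weights i *_) (const i w≢0)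

face-≡ : ∀ {d} {S : Pred (Point d) 0ℓ} {c : Point d} (f : Point d) {M} →
         (∀ {s} → S s → Maximizers (ConvexHull S) c s → f · s ≡ M) →
         ∀ {p} → Maximizers (ConvexHull S) c p → f · p ≡ M
face-≡ f const p∈F = hull-≡ f (member p∈F) λ i w≢0 →
  const (ConvexHull.points∈S (member p∈F) i) (support∈F p∈F i w≢0)

-- Sorting permutations and rearrangement

-- Unlike `z / 1`, which passes through a gcd, this is a normal form on the nose, and `⌜ i ⌝` is an
-- instance of it by computation.
ι : ℤ → ℚ
ι z = ℚ.mkℚ z 0 (Coprime.sym (Coprime.1-coprimeTo _))

/1≡ι : ∀ z → z / 1 ≡ ι z
/1≡ι z = ℚ.↥p/↧p≡p (ι z)

ι-+ : ∀ x y → ι x + ι y ≡ ι (x ℤ.+ y)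
ι-+ x y = trans (cong (_/ 1) (cong₂ ℤ._+_ (ℤ.*-identityʳ x) (ℤ.*-identityʳ y))) (/1≡ι (x ℤ.+ y))

ι-* : ∀ x y → ι x * ι y ≡ ι (x ℤ.* y)
ι-* x y = /1≡ι (x ℤ.* y)

ι-neg : ∀ x → - ι x ≡ ι (ℤ.- x)
ι-neg (+ zero)    = refl
ι-neg (+ suc _)   = refl
ι-neg -[1+ _ ]    = refl

ι-cancel-≤ : ∀ {x y} → ι x ≤ ι y → x ℤ.≤ y
ι-cancel-≤ {x} {y} (ℚ.*≤* x≤y) = ℤ.*-cancelʳ-≤-pos x y (+ 1) x≤y

ι-cancel-< : ∀ {x y} → ι x < ι y → x ℤ.< y
ι-cancel-< (ℚ.*<* x<y) = ℤ.*-cancelʳ-<-nonNeg (+ 1) x<y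

ι-sum : ∀ {n B} (f : Fin n → ℕ) → (∀ l → f l ℕ.≤ B) →
        ∃[ M ] ∑[ l < n ] ι (+ f l) ≡ ι (+ M) × M ℕ.≤ n ℕ.* B
ι-sum {zero}  f f≤B = 0 , refl , ℕ.z≤n
ι-sum {suc n} f f≤B with ι-sum (f ∘ suc) (f≤B ∘ suc)
... | M , eq , M≤ = f zero ℕ.+ M , trans (cong (_+_ (ι (+ f zero))) eq) (ι-+ (+ f zero) (+ M)) , ℕ.+-mono-≤ (f≤B zero) M≤

swap-i : ∀ {N} (σ : Permutation′ N) i j → swap i j σ ⟨$⟩ʳ i ≡ σ ⟨$⟩ʳ j
swap-i σ i j rewrite dec-true (i Fin.≟ i) refl = refl

swap-j : ∀ {N} (σ : Permutation′ N) i j → swap i j σ ⟨$⟩ʳ j ≡ σ ⟨$⟩ʳ i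
swap-j σ i j with j Fin.≟ i
... | yes refl = refl
... | no _ rewrite dec-true (j Fin.≟ j) refl = refl

swap-other : ∀ {N} (σ : Permutation′ N) i j {l} → l ≢ i → l ≢ j → swap i j σ ⟨$⟩ʳ l ≡ σ ⟨$⟩ʳ l
swap-other σ i j {l} l≢i l≢j rewrite dec-false (l Fin.≟ i) l≢i | dec-false (l Fin.≟ j) l≢j = refl

adjacent⇒increasing : ∀ {N} (f : Fin N → Fin N) →
  (∀ {a b} → toℕ b ≡ suc (toℕ a) → f a Fin.< f b) → ∀ {a b} → a Fin.< b → f a Fin.< f b
adjacent⇒increasing {N} f adjacent {a} {b} a<b = go (toℕ b ℕ.∸ suc (toℕ a)) b (sym (ℕ.m∸n+n≡m a<b))
  where
  go : ∀ d b → toℕ b ≡ d ℕ.+ suc (toℕ a) → f a Fin.< f b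
  go zero    b eq = adjacent eq
  go (suc d) b eq = ℕ.<-trans (go d b′ (Fin.toℕ-fromℕ< b′<N)) (adjacent (trans eq (cong suc (sym (Fin.toℕ-fromℕ< b′<N)))))
    where
    b′<N : d ℕ.+ suc (toℕ a) ℕ.< N
    b′<N = ℕ.≤-trans (ℕ.≤-reflexive (sym eq)) (ℕ.<⇒≤ (Fin.toℕ<n b))
    b′ = fromℕ< b′<N

-- σ after the inverse of τ is an increasing self-map of `Fin N`, hence lies above the identity; so
-- does its inverse.
increasing-permutations : ∀ {N} (σ τ : Permutation′ N) →
  (∀ {i j} → (τ ⟨$⟩ʳ i) Fin.< (τ ⟨$⟩ʳ j) → (σ ⟨$⟩ʳ i) Fin.< (σ ⟨$⟩ʳ j)) → permPoint τ ≡ permPoint σ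
increasing-permutations σ τ mono = Vec.tabulate-cong λ i → cong ⌜_⌝
  (Fin.≤-antisym (below σ τ mono i) (below τ σ mono⁻¹ i))
  where
  below : ∀ σ τ → (∀ {i j} → (τ ⟨$⟩ʳ i) Fin.< (τ ⟨$⟩ʳ j) → (σ ⟨$⟩ʳ i) Fin.< (σ ⟨$⟩ʳ j)) →
          ∀ i → (τ ⟨$⟩ʳ i) Fin.≤ (σ ⟨$⟩ʳ i)
  below σ τ mono i = subst (λ x → (τ ⟨$⟩ʳ i) Fin.≤ (σ ⟨$⟩ʳ x)) (inverseˡ τ)
    (increasing⇒≤ (λ a → σ ⟨$⟩ʳ (τ ⟨$⟩ˡ a))
      (λ a<b → mono (subst₂ Fin._<_ (sym (inverseʳ τ)) (sym (inverseʳ τ)) a<b)) (τ ⟨$⟩ʳ i))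
  mono⁻¹ : ∀ {i j} → (σ ⟨$⟩ʳ i) Fin.< (σ ⟨$⟩ʳ j) → (τ ⟨$⟩ʳ i) Fin.< (τ ⟨$⟩ʳ j)
  mono⁻¹ {i} {j} lt with Fin.<-cmp (τ ⟨$⟩ʳ i) (τ ⟨$⟩ʳ j)
  ... | tri< τi<τj _ _ = τi<τj
  ... | tri≈ _ eq _ = contradiction lt (Fin.<-irrefl (cong (σ ⟨$⟩ʳ_) (σ-injective τ eq)))
  ... | tri> _ _ gt = contradiction lt (Fin.<-asym (mono gt))

-- Bubble sort of τ towards σ.  The termination measure is the scalar product
-- with σ, an integer that every step increases.
module _ {N} (σ : Permutation′ N) where

  private
    bound : ℕ
    bound = N ℕ.* (N ℕ.* N)

    measure : ∀ (τ : Permutation′ N) → ∃[ M ] permPoint σ · permPoint τ ≡ ι (+ M) × M ℕ.≤ bound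
    measure τ with ι-sum (λ l → suc (toℕ (σ ⟨$⟩ʳ l)) ℕ.* suc (toℕ (τ ⟨$⟩ʳ l)))
                         (λ l → ℕ.*-mono-≤ (Fin.toℕ<n (σ ⟨$⟩ʳ l)) (Fin.toℕ<n (τ ⟨$⟩ʳ l)))
    ... | M , eq , M≤ = M , trans (sum-cong-≗ {N} term) eq , M≤
      where
      term : ∀ l → lookup (permPoint σ) l * lookup (permPoint τ) l
                   ≡ ι (+ (suc (toℕ (σ ⟨$⟩ʳ l)) ℕ.* suc (toℕ (τ ⟨$⟩ʳ l))))
      term l = trans (cong₂ _*_ (Vec.lookup∘tabulate (λ i → ⌜ σ ⟨$⟩ʳ i ⌝) l) (Vec.lookup∘tabulate (λ i → ⌜ τ ⟨$⟩ʳ i ⌝) l))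
        (ι-* (+ suc (toℕ (σ ⟨$⟩ʳ l))) (+ suc (toℕ (τ ⟨$⟩ʳ l))))

    measure-increases : ∀ τ {i j} → (τ ⟨$⟩ʳ i) Fin.< (τ ⟨$⟩ʳ j) → (σ ⟨$⟩ʳ j) Fin.< (σ ⟨$⟩ʳ i) →
                        proj₁ (measure τ) ℕ.< proj₁ (measure (swap i j τ))
    measure-increases τ {i} {j} τi<τj σj<σi = ℤ.drop‿+<+ (ι-cancel-<
      (subst₂ _<_ (proj₁ (proj₂ (measure τ))) (proj₁ (proj₂ (measure (swap i j τ))))
        (<-+ (·-swap (permPoint σ) τ i≢j) (0<product (⌜⌝-mono τi<τj)
          (subst₂ _<_ (sym (Vec.lookup∘tabulate _ j)) (sym (Vec.lookup∘tabulate _ i)) (⌜⌝-mono σj<σi))))))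
      where
      i≢j : i ≢ j
      i≢j refl = Fin.<-irrefl refl τi<τj

    unsorted? : ∀ (τ : Permutation′ N) → Dec (∃[ i ] ∃[ j ] toℕ (τ ⟨$⟩ʳ j) ≡ suc (toℕ (τ ⟨$⟩ʳ i)) × (σ ⟨$⟩ʳ j) Fin.< (σ ⟨$⟩ʳ i))
    unsorted? τ = Fin.any? λ i → Fin.any? λ j →
      (toℕ (τ ⟨$⟩ʳ j) ℕ.≟ suc (toℕ (τ ⟨$⟩ʳ i))) ×-dec ((σ ⟨$⟩ʳ j) Fin.<? (σ ⟨$⟩ʳ i))

  -- Only positions with consecutive values are swapped, which is what later makes every step an
  -- edge. The base case speaks of points because permutations with the same values need not be
  -- equal as records.
  sort-induction : (P : Permutation′ N → Set) →
    (∀ τ → permPoint τ ≡ permPoint σ → P τ) →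
    (∀ τ i j → toℕ (τ ⟨$⟩ʳ j) ≡ suc (toℕ (τ ⟨$⟩ʳ i)) → (σ ⟨$⟩ʳ j) Fin.< (σ ⟨$⟩ʳ i) → P (swap i j τ) → P τ) →
    ∀ τ → P τ
  sort-induction P base step τ = go bound τ (ℕ.m≤n+m bound _)
    where
    go : ∀ fuel τ → bound ℕ.≤ proj₁ (measure τ) ℕ.+ fuel → P τ
    go fuel τ enough with unsorted? τ
    ... | no sorted = base τ (increasing-permutations σ τ λ {i} {j} lt → subst₂ (λ x y → (σ ⟨$⟩ʳ x) Fin.< (σ ⟨$⟩ʳ y))
            (inverseˡ τ) (inverseˡ τ) (adjacent⇒increasing (λ a → σ ⟨$⟩ʳ (τ ⟨$⟩ˡ a)) adjacent lt))
      where
      adjacent : ∀ {a b} → toℕ b ≡ suc (toℕ a) → (σ ⟨$⟩ʳ (τ ⟨$⟩ˡ a)) Fin.< (σ ⟨$⟩ʳ (τ ⟨$⟩ˡ b))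
      adjacent {a} {b} eq with Fin.<-cmp (σ ⟨$⟩ʳ (τ ⟨$⟩ˡ a)) (σ ⟨$⟩ʳ (τ ⟨$⟩ˡ b))
      ... | tri< lt _ _ = lt
      ... | tri≈ _ same _ = contradiction
              (trans (sym eq) (cong toℕ (trans (sym (inverseʳ τ)) (trans (cong (τ ⟨$⟩ʳ_) (sym (σ-injective σ same))) (inverseʳ τ)))))
              ℕ.1+n≢n
      ... | tri> _ _ gt = contradiction
              (τ ⟨$⟩ˡ a , τ ⟨$⟩ˡ b , trans (cong toℕ (inverseʳ τ)) (trans eq (cong (suc ∘ toℕ) (sym (inverseʳ τ)))) , gt)
              sorted
    ... | yes (i , j , adj , σj<σi) with fuel
    ...   | zero = contradiction (proj₂ (proj₂ (measure (swap i j τ)))) (ℕ.<⇒≱ (ℕ.≤-<-trans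
              (ℕ.≤-trans enough (ℕ.≤-reflexive (ℕ.+-identityʳ _)))
              (measure-increases τ (ℕ.≤-reflexive (sym adj)) σj<σi)))
    ...   | suc fuel = step τ i j adj σj<σi (go fuel (swap i j τ) (ℕ.≤-trans enough
              (ℕ.≤-trans (ℕ.≤-reflexive (ℕ.+-suc _ fuel))
                (ℕ.+-monoˡ-≤ fuel (measure-increases τ (ℕ.≤-reflexive (sym adj)) σj<σi)))))

-- Maximizers of a functional and the rearrangement inequality

Monotone : ∀ {N} → Point N → Permutation′ N → Set
Monotone c σ = ∀ {i j} → lookup c i < lookup c j → (σ ⟨$⟩ʳ i) Fin.< (σ ⟨$⟩ʳ j)

-- A sorting step swaps i and j where τ i < τ j but σ j < σ i. By monotonicity of σ the latter
-- excludes c i < c j, so the swap does not lower the scalar product with c. Ties in c are harmless.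
rearrangement : ∀ {N} (c : Point N) (σ : Permutation′ N) → Monotone c σ →
                ∀ τ → c · permPoint τ ≤ c · permPoint σ
rearrangement c σ mono = sort-induction σ (λ τ → c · permPoint τ ≤ c · permPoint σ)
  (λ τ eq → ℚ.≤-reflexive (cong (c ·_) eq))
  (λ τ i j adj σj<σi → ℚ.≤-trans (improves τ adj σj<σi))
  where
  improves : ∀ τ {i j} → toℕ (τ ⟨$⟩ʳ j) ≡ suc (toℕ (τ ⟨$⟩ʳ i)) → (σ ⟨$⟩ʳ j) Fin.< (σ ⟨$⟩ʳ i) →
             c · permPoint τ ≤ c · permPoint (swap i j τ)
  improves τ {i} {j} adj σj<σi = subst₂ _≤_ (ℚ.+-identityʳ _) (sym (·-swap c τ i≢j))
    (ℚ.+-monoʳ-≤ (c · permPoint τ) (ℚ.≤-trans (ℚ.≤-reflexive (sym (ℚ.*-zeroʳ gap)))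
      (ℚ.*-monoˡ-≤-nonNeg gap {{ℚ.nonNegative (ℚ.<⇒≤ (p<q⇒0<q-p (⌜⌝-mono τi<τj)))}} (p≤q⇒0≤q-p cj≤ci))))
    where
    gap = ⌜ τ ⟨$⟩ʳ j ⌝ - ⌜ τ ⟨$⟩ʳ i ⌝
    τi<τj : (τ ⟨$⟩ʳ i) Fin.< (τ ⟨$⟩ʳ j)
    τi<τj = ℕ.≤-reflexive (sym adj)
    i≢j : i ≢ j
    i≢j refl = Fin.<-irrefl refl σj<σi
    cj≤ci : lookup c j ≤ lookup c i
    cj≤ci = ℚ.≮⇒≥ λ ci<cj → Fin.<-asym σj<σi (mono ci<cj)

monotone⇒maximizer : ∀ {N} {c : Point N} (σ : Permutation′ N) → Monotone c σ →
                     Maximizers (ConvexHull PermPoint) c (permPoint σ)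
monotone⇒maximizer {c = c} σ mono = perm∈P σ , hull-≤ c λ { (τ , refl) → rearrangement c σ mono τ }

-- Pigeonhole: punching out a missed value would inject `Fin (suc N)` into `Fin N`.
injection⇒permutation : ∀ {N} (f : Fin N → Fin N) → (∀ {i j} → f i ≡ f j → i ≡ j) →
                        Σ[ σ ∈ Permutation′ N ] ∀ i → σ ⟨$⟩ʳ i ≡ f i
injection⇒permutation {N} f f-inj =
  permutation f f⁻¹ f∘f⁻¹ (λ x → f-inj (f∘f⁻¹ (f x))) , λ _ → refl
  where
  preimage : ∀ {N} (f : Fin N → Fin N) → (∀ {i j} → f i ≡ f j → i ≡ j) → ∀ y → ∃[ x ] f x ≡ y
  preimage {suc N} f f-inj y with Fin.any? (λ x → f x Fin.≟ y)
  ... | yes found = found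
  ... | no  none  = contradiction
          (Fin.injective⇒≤ {f = λ x → punchOut (missed x)} (λ {x} {x′} eq →
            f-inj (Fin.punchOut-injective (missed x) (missed x′) eq)))
          ℕ.1+n≰n
    where
    missed : ∀ x → y ≢ f x
    missed x eq = none (x , sym eq)
  f⁻¹ : Fin N → Fin N
  f⁻¹ y = proj₁ (preimage f f-inj y)
  f∘f⁻¹ : ∀ y → f (f⁻¹ y) ≡ y
  f∘f⁻¹ y = proj₂ (preimage f f-inj y)

-- The rank counts the elements strictly below. It is defined for partial orders too: it is used
-- both for a tie-broken order, where it is injective, and for a normal vector with ties, where
-- `rank-cong` preserves them.
module Rank {N} {_⊏_ : Rel (Fin N) 0ℓ} (_⊏?_ : Binary.Decidable _⊏_)
            (⊏-irrefl : ∀ {i} → ¬ i ⊏ i) (⊏-trans : ∀ {i j k} → i ⊏ j → j ⊏ k → i ⊏ k) where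

  private
    below : Fin N → Subset N
    below i = tabulate λ j → does (j ⊏? i)

    ∈-below⁺ : ∀ {i j} → j ⊏ i → j Subset.∈ below i
    ∈-below⁺ {i} {j} j⊏i = Vec.lookup⇒[]= j (below i) (trans (Vec.lookup∘tabulate _ j) (dec-true (j ⊏? i) j⊏i))

    ∈-below⁻ : ∀ {i j} → j Subset.∈ below i → j ⊏ i
    ∈-below⁻ {i} {j} j∈ with j ⊏? i | trans (sym (Vec.lookup∘tabulate (λ j → does (j ⊏? i)) j)) (Vec.[]=⇒lookup j∈)
    ... | yes j⊏i | _  = j⊏i
    ... | no _    | ()

    below<N : ∀ i → Subset.∣ below i ∣ ℕ.< N
    below<N i = subst (Subset.∣ below i ∣ ℕ.<_) (Subset.∣⊤∣≡n N)
      (Subset.p⊂q⇒∣p∣<∣q∣ ((λ _ → Subset.∈⊤) , i , Subset.∈⊤ , λ i∈ → ⊏-irrefl (∈-below⁻ i∈)))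

  rank : Fin N → Fin N
  rank i = fromℕ< (below<N i)

  rank-mono : ∀ {i j} → i ⊏ j → rank i Fin.< rank j
  rank-mono {i} {j} i⊏j = subst₂ ℕ._<_ (sym (Fin.toℕ-fromℕ< (below<N i))) (sym (Fin.toℕ-fromℕ< (below<N j)))
    (Subset.p⊂q⇒∣p∣<∣q∣ ((λ k∈ → ∈-below⁺ (⊏-trans (∈-below⁻ k∈) i⊏j)) , i , ∈-below⁺ i⊏j , λ i∈ → ⊏-irrefl (∈-below⁻ i∈)))

  rank-cong : ∀ {i j} → (∀ {k} → k ⊏ i → k ⊏ j) → (∀ {k} → k ⊏ j → k ⊏ i) → rank i ≡ rank j
  rank-cong {i} {j} to from = Fin.toℕ-injective (trans (Fin.toℕ-fromℕ< (below<N i)) (trans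
    (cong Subset.∣_∣ (Subset.⊆-antisym (λ k∈ → ∈-below⁺ (to (∈-below⁻ k∈))) (λ k∈ → ∈-below⁺ (from (∈-below⁻ k∈)))))
    (sym (Fin.toℕ-fromℕ< (below<N j)))))

module TieBreak {N} {_◁_ : Rel (Fin N) 0ℓ} (◁-isStrictTotalOrder : IsStrictTotalOrder _≡_ _◁_) (c : Point N) where

  private
    module ◁ = IsStrictTotalOrder ◁-isStrictTotalOrder

    _⊏_ : Rel (Fin N) 0ℓ
    i ⊏ j = lookup c i < lookup c j ⊎ (lookup c i ≡ lookup c j × i ◁ j)

    _⊏?_ : Binary.Decidable _⊏_
    i ⊏? j = (lookup c i ℚ.<? lookup c j) ⊎-dec ((lookup c i ℚ.≟ lookup c j) ×-dec (i ◁.<? j))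

    ⊏-irrefl : ∀ {i} → ¬ i ⊏ i
    ⊏-irrefl (inj₁ lt)       = ℚ.<-irrefl refl lt
    ⊏-irrefl (inj₂ (_ , lt)) = ◁.irrefl refl lt

    ⊏-trans : ∀ {i j k} → i ⊏ j → j ⊏ k → i ⊏ k
    ⊏-trans (inj₁ p)        (inj₁ q)        = inj₁ (ℚ.<-trans p q)
    ⊏-trans (inj₁ p)        (inj₂ (e , _))  = inj₁ (subst (_ <_) e p)
    ⊏-trans (inj₂ (e , _))  (inj₁ q)        = inj₁ (subst (_< _) (sym e) q)
    ⊏-trans (inj₂ (e , p))  (inj₂ (e′ , q)) = inj₂ (trans e e′ , ◁.trans p q)

    ⊏-total : ∀ {i j} → i ≢ j → i ⊏ j ⊎ j ⊏ i
    ⊏-total {i} {j} i≢j with ℚ.<-cmp (lookup c i) (lookup c j)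
    ... | tri< lt _ _ = inj₁ (inj₁ lt)
    ... | tri> _ _ gt = inj₂ (inj₁ gt)
    ... | tri≈ _ eq _ with ◁.compare i j
    ...   | tri< lt _ _   = inj₁ (inj₂ (eq , lt))
    ...   | tri≈ _ i≡j _  = contradiction i≡j i≢j
    ...   | tri> _ _ gt   = inj₂ (inj₂ (sym eq , gt))

    open Rank _⊏?_ ⊏-irrefl (λ {i} {j} {k} → ⊏-trans {i} {j} {k})

    rank-injective : ∀ {i j} → rank i ≡ rank j → i ≡ j
    rank-injective {i} {j} eq with i Fin.≟ j
    ... | yes i≡j = i≡j
    ... | no  i≢j with ⊏-total i≢j
    ...   | inj₁ lt = contradiction (rank-mono lt) (Fin.<-irrefl eq)
    ...   | inj₂ gt = contradiction (rank-mono gt) (Fin.<-irrefl (sym eq))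

    ranking = injection⇒permutation rank rank-injective

  sorted : Permutation′ N
  sorted = proj₁ ranking

  sorted-monotone : Monotone c sorted
  sorted-monotone lt = subst₂ Fin._<_ (sym (proj₂ ranking _)) (sym (proj₂ ranking _)) (rank-mono (inj₁ lt))

  sorted-tie : ∀ {i j} → lookup c i ≡ lookup c j → i ◁ j → (sorted ⟨$⟩ʳ i) Fin.< (sorted ⟨$⟩ʳ j)
  sorted-tie eq lt = subst₂ Fin._<_ (sym (proj₂ ranking _)) (sym (proj₂ ranking _)) (rank-mono (inj₂ (eq , lt)))

-- Breaking ties by increasing index creates no inversion inside a level; breaking them by
-- decreasing index creates all of them. These are the extreme vertices of the face.
module Bottom {N} = TieBreak {N} Fin.<-isStrictTotalOrder
module Top    {N} = TieBreak {N} (Flip.isStrictTotalOrder Fin.<-isStrictTotalOrder)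

indicator : ∀ {A : Set} → Dec A → ℚ
indicator d = if does d then 1ℚ else 0ℚ

indicator-< : ∀ {A B : Set} (d : Dec A) (e : Dec B) → indicator d < indicator e → ¬ A × B
indicator-< (no ¬a) (yes b) _  = ¬a , b
indicator-< (yes _) (yes _) lt = contradiction lt (ℚ.<-irrefl refl)
indicator-< (no _)  (no _)  lt = contradiction lt (ℚ.<-irrefl refl)
indicator-< (yes _) (no _)  (ℚ.*<* (ℤ.+<+ ()))

-- A permutation that sorts c also sorts the coarser h, so both maximise h.
coarsening-constant : ∀ {N} (c h : Point N) → (∀ {i j} → lookup h i < lookup h j → lookup c i < lookup c j) →
                      ∀ σ τ → Monotone c σ → Monotone c τ → h · permPoint σ ≡ h · permPoint τ
coarsening-constant c h coarser σ τ mσ mτ = ℚ.≤-antisym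
  (rearrangement h τ (mτ ∘ coarser) σ) (rearrangement h σ (mσ ∘ coarser) τ)

module _ {N} (c : Point N) (x : ℚ) where

  level : Point N
  level = tabulate λ l → indicator (lookup c l ℚ.≟ x)

  private
    from above : Point N
    from  = tabulate λ l → indicator (x ℚ.≤? lookup c l)
    above = tabulate λ l → indicator (x ℚ.<? lookup c l)

    from-coarser : ∀ {i j} → lookup from i < lookup from j → lookup c i < lookup c j
    from-coarser {i} {j} lt with indicator-< (x ℚ.≤? lookup c i) (x ℚ.≤? lookup c j)
                                  (subst₂ _<_ (Vec.lookup∘tabulate _ i) (Vec.lookup∘tabulate _ j) lt)
    ... | x≰ci , x≤cj = ℚ.<-≤-trans (ℚ.≰⇒> x≰ci) x≤cj

    above-coarser : ∀ {i j} → lookup above i < lookup above j → lookup c i < lookup c j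
    above-coarser {i} {j} lt with indicator-< (x ℚ.<? lookup c i) (x ℚ.<? lookup c j)
                                   (subst₂ _<_ (Vec.lookup∘tabulate _ i) (Vec.lookup∘tabulate _ j) lt)
    ... | x≮ci , x<cj = ℚ.≤-<-trans (ℚ.≮⇒≥ x≮ci) x<cj

    split : ∀ y → indicator (x ℚ.≤? y) ≡ indicator (y ℚ.≟ x) + indicator (x ℚ.<? y)
    split y with ℚ.<-cmp x y
    ... | tri< lt neq _ rewrite dec-true (x ℚ.≤? y) (ℚ.<⇒≤ lt) | dec-false (y ℚ.≟ x) (neq ∘ sym)
                              | dec-true (x ℚ.<? y) lt = refl
    ... | tri≈ nlt eq _ rewrite dec-true (x ℚ.≤? y) (ℚ.≤-reflexive eq) | dec-true (y ℚ.≟ x) (sym eq)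
                              | dec-false (x ℚ.<? y) nlt = refl
    ... | tri> nlt neq gt rewrite dec-false (x ℚ.≤? y) (<-≤-absurd gt) | dec-false (y ℚ.≟ x) (neq ∘ sym)
                              | dec-false (x ℚ.<? y) nlt = refl

    from-split : ∀ p → from · p ≡ level · p + above · p
    from-split p = trans (sum-cong-≗ {N} term) (∑-distrib-+ {N} (λ l → lookup level l * lookup p l) (λ l → lookup above l * lookup p l))
      where
      term : ∀ l → lookup from l * lookup p l ≡ lookup level l * lookup p l + lookup above l * lookup p l
      term l = trans (cong (_* lookup p l) (trans (Vec.lookup∘tabulate _ l) (trans (split (lookup c l))
          (sym (cong₂ _+_ (Vec.lookup∘tabulate _ l) (Vec.lookup∘tabulate _ l))))))
        (ℚ.*-distribʳ-+ (lookup p l) (lookup level l) (lookup above l))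

    -- The indicator of a single level need not be a coarsening of c, but it is the difference of
    -- the indicators of two upper sets, `from` and `above`, which are.
    level-monotone : ∀ σ τ → Monotone c σ → Monotone c τ → level · permPoint σ ≡ level · permPoint τ
    level-monotone σ τ mσ mτ = +-group.∙-cancelʳ (above · permPoint σ) (level · permPoint σ) (level · permPoint τ) (begin
      level · permPoint σ + above · permPoint σ  ≡⟨ from-split (permPoint σ) ⟨
      from · permPoint σ                         ≡⟨ coarsening-constant c from from-coarser σ τ mσ mτ ⟩
      from · permPoint τ                         ≡⟨ from-split (permPoint τ) ⟩
      level · permPoint τ + above · permPoint τ  ≡⟨ cong (_+_ (level · permPoint τ)) (coarsening-constant c above above-coarser τ σ mτ mσ) ⟩
      level · permPoint τ + above · permPoint σ  ∎)
      where open ≡-Reasoning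

  -- In terms of ordered partitions, the coordinates in each part have a constant sum on the face.
  -- These are the equations that bound its dimension from above.
  level-constant : ∃[ M ] (∀ {p} → Maximizers (ConvexHull PermPoint) c p → level · p ≡ M)
  level-constant = level · permPoint σ , face-≡ level λ where
      (τ , refl) τ∈F → level-monotone τ σ (λ {i} {j} → maximizer-monotone {c = c} τ τ∈F {i} {j}) sorted-monotone
    where
    open Bottom c renaming (sorted to σ)

-- The dimension of a face

Dependence : ∀ {d m} → (Fin m → Point d) → Set
Dependence {d} {m} v = Σ[ w ∈ (Fin m → ℚ) ] (∃[ i ] w i ≢ 0ℚ) × sum w ≡ 0ℚ × combine w v ≡ replicate d 0ℚ

module _ {d m} {p : Point d} {b : Fin m → Point d} (b-independent : AffinelyIndependent b)
         (u : Fin (suc m) → ℚ) (u≢0 : ∃[ i ] u i ≢ 0ℚ) (Σu≡0 : sum u ≡ 0ℚ)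
         (comb≡0 : combine u (p Vector.∷ b) ≡ replicate d 0ℚ) where

  private
    open ≡-Reasoning

    relation : ∀ l → u zero * lookup p l + lookup (combine (u ∘ suc) b) l ≡ 0ℚ
    relation l = begin
      u zero * lookup p l + lookup (combine (u ∘ suc) b) l
        ≡⟨ cong (_+_ (u zero * lookup p l)) (lookup-combine (u ∘ suc) b l) ⟩
      u zero * lookup p l + ∑[ a < m ] (u (suc a) * lookup (b a) l)
        ≡⟨ lookup-combine u (p Vector.∷ b) l ⟨
      lookup (combine u (p Vector.∷ b)) l
        ≡⟨ trans (cong (λ x → lookup x l) comb≡0) (Vec.lookup-replicate l 0ℚ) ⟩
      0ℚ ∎

    u₀≢0 : u zero ≢ 0ℚ
    u₀≢0 u₀≡0 = proj₂ u≢0 (all≡0 (proj₁ u≢0))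
      where
      drop : ∀ x {s} → u zero * x + s ≡ 0ℚ → s ≡ 0ℚ
      drop x {s} eq = trans (sym (ℚ.+-identityˡ s))
        (trans (cong (_+ s) (sym (trans (cong (_* x) u₀≡0) (ℚ.*-zeroˡ x)))) eq)
      all≡0 : ∀ i → u i ≡ 0ℚ
      all≡0 zero    = u₀≡0
      all≡0 (suc a) = b-independent (u ∘ suc)
        (trans (sym (ℚ.+-identityˡ (sum (u ∘ suc)))) (trans (cong (_+ sum (u ∘ suc)) (sym u₀≡0)) Σu≡0))
        (vec-ext λ l → trans (drop (lookup p l) (relation l)) (sym (Vec.lookup-replicate l 0ℚ))) a

    inv : ℚ
    inv = (1/ u zero) {{ℚ.≢-nonZero u₀≢0}}

    w : Fin m → ℚ
    w a = (- inv) * u (suc a)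

    normalise : ∀ x s → u zero * x + s ≡ 0ℚ → (- inv) * s ≡ x
    normalise x s eq = begin
      (- inv) * s
        ≡⟨ solve 4 (λ i s u x → (:- i) :* s := u :* i :* x :- i :* (u :* x :+ s)) refl inv s (u zero) x ⟩
      u zero * inv * x - inv * (u zero * x + s)
        ≡⟨ cong₂ (λ a b → a * x - inv * b) (ℚ.*-inverseʳ (u zero) {{ℚ.≢-nonZero u₀≢0}}) eq ⟩
      1ℚ * x - inv * 0ℚ
        ≡⟨ solve 2 (λ x i → con 1ℚ :* x :- i :* con 0ℚ := x) refl x inv ⟩
      x ∎

    Σw≡1 : sum w ≡ 1ℚ
    Σw≡1 = trans (sym (*-distribˡ-sum (- inv) (u ∘ suc)))
      (normalise 1ℚ (sum (u ∘ suc)) (trans (cong (_+ sum (u ∘ suc)) (ℚ.*-identityʳ (u zero))) Σu≡0))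

    agrees : ∀ l → lookup p l ≡ lookup (combine w b) l
    agrees l = sym (begin
      lookup (combine w b) l
        ≡⟨ lookup-combine w b l ⟩
      ∑[ a < m ] ((- inv) * u (suc a) * lookup (b a) l)
        ≡⟨ sum-cong-≗ {m} (λ a → ℚ.*-assoc (- inv) (u (suc a)) (lookup (b a) l)) ⟩
      ∑[ a < m ] ((- inv) * (u (suc a) * lookup (b a) l))
        ≡⟨ *-distribˡ-sum {m} (- inv) (λ a → u (suc a) * lookup (b a) l) ⟨
      (- inv) * ∑[ a < m ] (u (suc a) * lookup (b a) l)
        ≡⟨ cong ((- inv) *_) (lookup-combine (u ∘ suc) b l) ⟨
      (- inv) * lookup (combine (u ∘ suc) b) l
        ≡⟨ normalise (lookup p l) (lookup (combine (u ∘ suc) b) l) (relation l) ⟩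
      lookup p l ∎)

  -- The coefficient of p is nonzero, as otherwise the remaining ones would be a dependence of b;
  -- dividing by it solves for p.
  dependence⇒combination : ∃[ w ] sum w ≡ 1ℚ × p ≡ combine w b
  dependence⇒combination = w , Σw≡1 , vec-ext agrees

-- A transversal of the level sets of c; the elements of Fin N outside of it are
-- enumerated by free.  The face with normal c has dimension r.
record Levels {N} (c : Point N) (r : ℕ) : Set where
  field
    rep            : Fin N → Fin N
    rep-level      : ∀ i → lookup c (rep i) ≡ lookup c i
    rep-cong       : ∀ {i j} → lookup c i ≡ lookup c j → rep i ≡ rep j
    free           : Fin r → Fin N
    free-injective : ∀ {a b} → free a ≡ free b → a ≡ b
    free≢rep       : ∀ a → rep (free a) ≢ free a
    free-complete  : ∀ {i} → rep i ≢ i → ∃[ a ] free a ≡ i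

  rep-idem : ∀ i → rep (rep i) ≡ rep i
  rep-idem i = rep-cong (rep-level i)

Levels-resp : ∀ {N r} {c d : Point N} → (∀ {i j} → lookup c i ≡ lookup c j → lookup d i ≡ lookup d j) →
              (∀ {i j} → lookup d i ≡ lookup d j → lookup c i ≡ lookup c j) → Levels c r → Levels d r
Levels-resp to from L = record
  { rep            = rep
  ; rep-level      = λ i → to (rep-level i)
  ; rep-cong       = λ eq → rep-cong (from eq)
  ; free           = free
  ; free-injective = free-injective
  ; free≢rep       = free≢rep
  ; free-complete  = free-complete
  }
  where open Levels L

record Enumeration {N} (P : Pred (Fin N) 0ℓ) : Set where
  field
    size      : ℕ
    at        : Fin size → Fin N
    injective : ∀ {a b} → at a ≡ at b → a ≡ b
    sound     : ∀ a → P (at a)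
    complete  : ∀ {i} → P i → ∃[ a ] at a ≡ i

enumerate : ∀ {N} {P : Pred (Fin N) 0ℓ} → Decidable P → Enumeration P
enumerate {zero} P? = record
  { size = 0 ; at = λ () ; injective = λ { {()} } ; sound = λ () ; complete = λ { {()} } }
enumerate {suc N} {P} P? with enumerate (P? ∘ suc) | P? zero
... | tail | no ¬p = record
  { size      = size
  ; at        = suc ∘ at
  ; injective = injective ∘ Fin.suc-injective
  ; sound     = sound
  ; complete  = λ { {zero}  p → contradiction p ¬p
                  ; {suc i} p → proj₁ (complete p) , cong suc (proj₂ (complete p)) }
  }
  where open Enumeration tail
... | tail | yes p = record
  { size      = suc size
  ; at        = at′
  ; injective = λ { {zero}  {zero}  _  → refl
                  ; {suc a} {suc b} eq → cong suc (injective (Fin.suc-injective eq)) }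
  ; sound     = λ where
      zero    → p
      (suc a) → sound a
  ; complete  = λ { {zero}  _ → zero , refl
                  ; {suc i} q → suc (proj₁ (complete q)) , cong suc (proj₂ (complete q)) }
  }
  where
  open Enumeration tail
  at′ : Fin (suc size) → Fin (suc N)
  at′ zero    = zero
  at′ (suc a) = suc (at a)

levels : ∀ {n} (c : Point (suc n)) → ∃[ r ] Levels c r
levels {n} c = Enumeration.size free , record
  { rep            = λ i → proj₁ (first (lookup c i))
  ; rep-level      = λ i → proj₂ (first (lookup c i)) (i , refl)
  ; rep-cong       = cong (proj₁ ∘ first)
  ; free           = Enumeration.at free
  ; free-injective = Enumeration.injective free
  ; free≢rep       = Enumeration.sound free
  ; free-complete  = Enumeration.complete free
  }
  where
  -- The representative is computed from the value x alone, so that `rep-cong` is a mere congruence;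
  -- `zero` is a default for values that are not attained.
  first : ∀ x → ∃[ j ] ((∃[ i ] lookup c i ≡ x) → lookup c j ≡ x)
  first x with Fin.any? (λ j → lookup c j ℚ.≟ x)
  ... | yes (j , eq) = j , λ _ → eq
  ... | no  none     = zero , λ some → contradiction some none
  free = enumerate (λ i → ¬? (proj₁ (first (lookup c i)) Fin.≟ i))

module _ {N r} {c : Point N} (L : Levels c r) where
  open Levels L

  private
    F : Pred (Point N) 0ℓ
    F = Maximizers (ConvexHull PermPoint) c

  -- Once the free coordinates are zero, the sum over a level reduces to the coordinate at its
  -- representative.
  vanishing : ∀ y → (∀ l → level c (lookup c l) · y ≡ 0ℚ) → (∀ a → lookup y (free a) ≡ 0ℚ) →
              ∀ l → lookup y l ≡ 0ℚ
  vanishing y level≡0 free≡0 l with rep l Fin.≟ l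
  ... | no  l-free with free-complete l-free
  ...   | a , refl = free≡0 a
  vanishing y level≡0 free≡0 l | yes l-rep = trans (sym (trans (sum-cong-≗ {N} term) (sum-δ (lookup y) l))) (level≡0 l)
    where
    term : ∀ i → lookup (level c (lookup c l)) i * lookup y i ≡ lookup y i * δ l i
    term i rewrite Vec.lookup∘tabulate (λ i → indicator (lookup c i ℚ.≟ lookup c l)) i
      with rep i Fin.≟ i
    ... | no i-free with free-complete i-free
    ...   | a , refl rewrite free≡0 a = trans (ℚ.*-zeroʳ (indicator (lookup c i ℚ.≟ lookup c l))) (sym (ℚ.*-zeroˡ (δ l i)))
    term i | yes i-rep with i Fin.≟ l
    ... | yes refl rewrite dec-true (lookup c i ℚ.≟ lookup c i) refl = ℚ.*-comm 1ℚ (lookup y i)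
    ... | no  i≢l rewrite dec-false (lookup c i ℚ.≟ lookup c l) (λ eq → i≢l (trans (sym i-rep) (trans (rep-cong eq) l-rep)))
            = ℚ.*-comm 0ℚ (lookup y i)

  module _ {m} (v : Fin m → Point N) (v∈F : ∀ i → F (v i)) where

    private
      system : Fin (suc r) → Fin m → ℚ
      system zero    i = 1ℚ
      system (suc a) i = lookup (v i) (free a)

    -- The system has r + 1 equations: the weights sum to zero and each free coordinate of the
    -- combination vanishes. The first also kills all level sums, since these are constant on the
    -- face, and `vanishing` does the rest.
    face-dependent : suc r ℕ.< m → Dependence v
    face-dependent r<m = from-solution (nontrivial-solution system r<m)
      where
      from-solution : NontrivialSolution system → Dependence v
      from-solution (w , w≢0 , solves) = w , w≢0 , Σw≡0 , vec-ext λ l →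
          trans (vanishing (combine w v) level≡0 free≡0 l) (sym (Vec.lookup-replicate l 0ℚ))
        where
        Σw≡0 : sum w ≡ 0ℚ
        Σw≡0 = trans (sum-cong-≗ {m} (λ i → sym (ℚ.*-identityˡ (w i)))) (solves zero)
        free≡0 : ∀ a → lookup (combine w v) (free a) ≡ 0ℚ
        free≡0 a = trans (lookup-combine w v (free a))
          (trans (sum-cong-≗ {m} (λ i → ℚ.*-comm (w i) (lookup (v i) (free a)))) (solves (suc a)))
        level≡0 : ∀ l → level c (lookup c l) · combine w v ≡ 0ℚ
        level≡0 l = begin
          level c (lookup c l) · combine w v                 ≡⟨ ·-combine (level c (lookup c l)) w v ⟩
          ∑[ i < m ] (w i * level c (lookup c l) · v i)      ≡⟨ sum-cong-≗ {m} (λ i → cong (w i *_) (proj₂ (level-constant c (lookup c l)) (v∈F i))) ⟩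
          ∑[ i < m ] (w i * M)                               ≡⟨ *-distribʳ-sum M w ⟨
          sum w * M                                          ≡⟨ cong (_* M) Σw≡0 ⟩
          0ℚ * M                                             ≡⟨ ℚ.*-zeroˡ M ⟩
          0ℚ                                                 ∎
          where
          open ≡-Reasoning
          M = proj₁ (level-constant c (lookup c l))

  dim-≤ : ∀ {s} → HasDim F s → s ℕ.≤ r
  dim-≤ {s} hasDim with s ℕ.≤? r
  ... | yes s≤r = s≤r
  ... | no  s≰r = impossible (face-dependent basis basis∈S (ℕ.s≤s (ℕ.≰⇒> s≰r)))
    where
    open HasDim hasDim
    impossible : Dependence basis → s ℕ.≤ r
    impossible (w , (i , wi≢0) , Σw≡0 , comb≡0) = contradiction (independent w Σw≡0 comb≡0 i) wi≢0

  private
    σ : Permutation′ N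
    σ = Bottom.sorted c

    rep≢free : ∀ a → rep (free a) ≢ free a
    rep≢free = free≢rep

    -- One vertex, together with its images under swapping a free index with its representative. In
    -- the free coordinates the differences from that vertex form a diagonal matrix with entries
    -- `- step a`.
    basis-perm : Fin (suc r) → Permutation′ N
    basis-perm zero    = σ
    basis-perm (suc a) = swap (rep (free a)) (free a) σ

    σ∈F : F (permPoint σ)
    σ∈F = monotone⇒maximizer σ (Bottom.sorted-monotone c)

    basis : Fin (suc r) → Point N
    basis a = permPoint (basis-perm a)

    basis∈F : ∀ a → F (basis a)
    basis∈F zero    = σ∈F
    basis∈F (suc a) = swap-maximizer σ (rep≢free a) (rep-level (free a)) σ∈F

    step : Fin r → ℚ
    step a = ⌜ σ ⟨$⟩ʳ free a ⌝ - ⌜ σ ⟨$⟩ʳ rep (free a) ⌝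

    step≢0 : ∀ a → step a ≢ 0ℚ
    step≢0 a = ⌜⌝-distinct λ eq → rep≢free a (sym (σ-injective σ eq))

    δ-free : ∀ a b → δ (free a) (free b) ≡ δ a b
    δ-free a b with b Fin.≟ a
    ... | yes refl rewrite dec-true (free b Fin.≟ free b) refl = refl
    ... | no  b≢a  rewrite dec-false (free b Fin.≟ free a) (b≢a ∘ free-injective) = refl

    δ-rep : ∀ a b → δ (rep (free a)) (free b) ≡ 0ℚ
    δ-rep a b rewrite dec-false (free b Fin.≟ rep (free a))
      (λ eq → free≢rep b (trans (cong rep eq) (trans (rep-idem (free a)) (sym eq)))) = refl

    basis-free : ∀ a b → lookup (basis (suc a)) (free b) ≡ ⌜ σ ⟨$⟩ʳ free b ⌝ - step a * δ a b
    basis-free a b = begin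
      lookup (basis (suc a)) (free b)
        ≡⟨ lookup-swap σ (rep≢free a) (free b) ⟩
      ⌜ σ ⟨$⟩ʳ free b ⌝ + step a * (δ (rep (free a)) (free b) - δ (free a) (free b))
        ≡⟨ cong₂ (λ x y → ⌜ σ ⟨$⟩ʳ free b ⌝ + step a * (x - y)) (δ-rep a b) (δ-free a b) ⟩
      ⌜ σ ⟨$⟩ʳ free b ⌝ + step a * (0ℚ - δ a b)
        ≡⟨ solve 3 (λ s t d → s :+ t :* (con 0ℚ :- d) := s :- t :* d) refl ⌜ σ ⟨$⟩ʳ free b ⌝ (step a) (δ a b) ⟩
      ⌜ σ ⟨$⟩ʳ free b ⌝ - step a * δ a b ∎
      where open ≡-Reasoning

    combine-free : ∀ w b → lookup (combine w basis) (free b)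
                         ≡ sum w * ⌜ σ ⟨$⟩ʳ free b ⌝ - w (suc b) * step b
    combine-free w b = begin
      lookup (combine w basis) (free b)
        ≡⟨ lookup-combine w basis (free b) ⟩
      w zero * lookup (basis zero) (free b) + ∑[ a < r ] (w (suc a) * lookup (basis (suc a)) (free b))
        ≡⟨ cong₂ (λ x y → w zero * x + y) (Vec.lookup∘tabulate (λ i → ⌜ σ ⟨$⟩ʳ i ⌝) (free b))
             (sum-cong-≗ {r} λ a → trans (cong (w (suc a) *_) (basis-free a b))
               (solve 4 (λ w s t d → w :* (s :- t :* d) := w :* s :+ (:- con 1ℚ) :* ((w :* t) :* d))
                 refl (w (suc a)) s (step a) (δ a b))) ⟩
      w zero * s + ∑[ a < r ] (w (suc a) * s + (- 1ℚ) * ((w (suc a) * step a) * δ a b))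
        ≡⟨ cong (_+_ (w zero * s)) (trans (∑-distrib-+ {r} (λ a → w (suc a) * s) (λ a → (- 1ℚ) * ((w (suc a) * step a) * δ a b)))
             (cong₂ _+_ (sym (*-distribʳ-sum s (w ∘ suc)))
               (trans (sym (*-distribˡ-sum {r} (- 1ℚ) (λ a → (w (suc a) * step a) * δ a b)))
                 (cong ((- 1ℚ) *_) (sum-δ′ (λ a → w (suc a) * step a) b))))) ⟩
      w zero * s + (sum (w ∘ suc) * s + (- 1ℚ) * (w (suc b) * step b))
        ≡⟨ solve 4 (λ w s r x → w :* s :+ (r :* s :+ (:- con 1ℚ) :* x) := (w :+ r) :* s :- x) refl
             (w zero) s (sum (w ∘ suc)) (w (suc b) * step b) ⟩
      sum w * s - w (suc b) * step b ∎
      where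
      open ≡-Reasoning
      s = ⌜ σ ⟨$⟩ʳ free b ⌝

    basis-independent : AffinelyIndependent basis
    basis-independent w Σw≡0 comb≡0 = λ where
        zero    → trans (sym (ℚ.+-identityʳ (w zero))) (trans (cong (_+_ (w zero)) (sym rest≡0)) Σw≡0)
        (suc b) → tail≡0 b
      where
      open ≡-Reasoning
      tail≡0 : ∀ b → w (suc b) ≡ 0ℚ
      tail≡0 b = *-zero-cancel (step≢0 b) (begin
        w (suc b) * step b                    ≡⟨ solve 2 (λ x s → x := :- (con 0ℚ :* s :- x)) refl (w (suc b) * step b) s ⟩
        - (0ℚ * s - w (suc b) * step b)       ≡⟨ cong (λ x → - (x * s - w (suc b) * step b)) Σw≡0 ⟨
        - (sum w * s - w (suc b) * step b)    ≡⟨ cong -_ (combine-free w b) ⟨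
        - lookup (combine w basis) (free b)   ≡⟨ cong (λ x → - lookup x (free b)) comb≡0 ⟩
        - lookup (replicate N 0ℚ) (free b)    ≡⟨ cong -_ (Vec.lookup-replicate (free b) 0ℚ) ⟩
        0ℚ                                    ∎)
        where
        s = ⌜ σ ⟨$⟩ʳ free b ⌝
      rest≡0 : sum (w ∘ suc) ≡ 0ℚ
      rest≡0 = trans (sum-cong-≗ {r} tail≡0) (sum-zero r)

    basis-spanning : ∀ {p} → F p → ∃[ w ] sum w ≡ 1ℚ × p ≡ combine w basis
    -- These are r + 2 points of the face, one too many to be independent.
    basis-spanning {p} p∈F = from-dependence (face-dependent (p Vector.∷ basis) points∈F ℕ.≤-refl)
      where
      points∈F : ∀ a → F ((p Vector.∷ basis) a)
      points∈F zero    = p∈F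
      points∈F (suc a) = basis∈F a
      from-dependence : Dependence (p Vector.∷ basis) → ∃[ w ] sum w ≡ 1ℚ × p ≡ combine w basis
      from-dependence (u , u≢0 , Σu≡0 , comb≡0) = dependence⇒combination {b = basis} basis-independent u u≢0 Σu≡0 comb≡0

  levels⇒hasDim : HasDim F r
  levels⇒hasDim = record
    { basis       = basis
    ; basis∈S     = basis∈F
    ; independent = basis-independent
    ; spanning    = basis-spanning
    }

-- Vertices, edges and the persistence of inversions

dim0⇒unique : ∀ {d} {S : Pred (Point d) 0ℓ} → HasDim S 0 → ∀ {p q} → S p → S q → p ≡ q
dim0⇒unique {S = S} dim0 Sp Sq = trans (is-basis Sp) (sym (is-basis Sq))
  where
  open HasDim dim0
  is-basis : ∀ {p} → S p → p ≡ basis zero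
  is-basis {p} Sp = vec-ext λ j → coordinate j (spanning Sp)
    where
    coordinate : ∀ j → ∃[ w ] sum w ≡ 1ℚ × p ≡ combine w basis → lookup p j ≡ lookup (basis zero) j
    coordinate j (w , Σw≡1 , refl) = trans (lookup-combine w basis j)
      (trans (sum-cong-≗ {1} {λ i → w i * lookup (basis i) j} {λ i → w i * lookup (basis zero) j} λ { zero → refl }) (sum-scale w Σw≡1 (lookup (basis zero) j)))

record Line {d} (S : Pred (Point d) 0ℓ) : Set where
  field
    origin direction : Point d
    parameter        : ∀ {p} → S p → ∃[ t ] (∀ l → lookup p l ≡ lookup origin l + t * lookup direction l)

dim1⇒line : ∀ {d} {S : Pred (Point d) 0ℓ} → HasDim S 1 → Line S
dim1⇒line {d} dim1 = record
  { origin    = basis zero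
  ; direction = direction
  ; parameter = λ Sp → from-span (spanning Sp)
  }
  where
  open HasDim dim1
  direction : Point d
  direction = tabulate λ l → lookup (basis (suc zero)) l - lookup (basis zero) l
  from-span : ∀ {p} → ∃[ w ] sum w ≡ 1ℚ × p ≡ combine w basis →
              ∃[ t ] (∀ l → lookup p l ≡ lookup (basis zero) l + t * lookup direction l)
  from-span (w , Σw≡1 , refl) = w (suc zero) , λ l → begin
    lookup (combine w basis) l
      ≡⟨ lookup-combine w basis l ⟩
    w zero * a l + (w (suc zero) * b l + 0ℚ)
      ≡⟨ solve 4 (λ w₀ w₁ a b → w₀ :* a :+ (w₁ :* b :+ con 0ℚ) := (w₀ :+ (w₁ :+ con 0ℚ)) :* a :+ w₁ :* (b :- a))
           refl (w zero) (w (suc zero)) (a l) (b l) ⟩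
    sum w * a l + w (suc zero) * (b l - a l)
      ≡⟨ cong₂ (λ s x → s * a l + w (suc zero) * x) Σw≡1 (sym (Vec.lookup∘tabulate _ l)) ⟩
    1ℚ * a l + w (suc zero) * lookup direction l
      ≡⟨ cong (_+ w (suc zero) * lookup direction l) (ℚ.*-identityˡ (a l)) ⟩
    a l + w (suc zero) * lookup direction l ∎
    where
    open ≡-Reasoning
    a b : Fin d → ℚ
    a = lookup (basis zero)
    b = lookup (basis (suc zero))

·-line : ∀ {d} (f o v p : Point d) {t} → (∀ l → lookup p l ≡ lookup o l + t * lookup v l) → f · p ≡ f · o + t * f · v
·-line {d} f o v p {t} on-line = begin
  ∑[ l < d ] (lookup f l * lookup p l)
    ≡⟨ sum-cong-≗ {d} (λ l → trans (cong (lookup f l *_) (on-line l))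
         (solve 4 (λ f o t v → f :* (o :+ t :* v) := f :* o :+ t :* (f :* v)) refl (lookup f l) (lookup o l) t (lookup v l))) ⟩
  ∑[ l < d ] (lookup f l * lookup o l + t * (lookup f l * lookup v l))
    ≡⟨ ∑-distrib-+ {d} (λ l → lookup f l * lookup o l) (λ l → t * (lookup f l * lookup v l)) ⟩
  f · o + ∑[ l < d ] (t * (lookup f l * lookup v l))
    ≡⟨ cong (_+_ (f · o)) (sym (*-distribˡ-sum {d} t (λ l → lookup f l * lookup v l))) ⟩
  f · o + t * f · v ∎
  where open ≡-Reasoning

0<q-p⇒p<q : ∀ {p q} → 0ℚ < q - p → p < q
0<q-p⇒p<q {p} {q} lt = subst₂ _<_ (ℚ.+-identityˡ p) (solve 2 (λ p q → (q :- p) :+ p := q) refl p q) (ℚ.+-monoˡ-< p lt)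

·-swap-weak : ∀ {N} (σ : Permutation′ N) {i j} → i ≢ j →
  weakBruhat · permPoint (swap i j σ)
  ≡ weakBruhat · permPoint σ + (⌜ σ ⟨$⟩ʳ j ⌝ - ⌜ σ ⟨$⟩ʳ i ⌝) * (⌜ i ⌝ - ⌜ j ⌝)
·-swap-weak {N} σ {i} {j} i≢j = trans (·-swap weakBruhat σ i≢j)
  (cong (λ x → weakBruhat · permPoint σ + (⌜ σ ⟨$⟩ʳ j ⌝ - ⌜ σ ⟨$⟩ʳ i ⌝) * x)
    (cong₂ _-_ (Vec.lookup∘tabulate ⌜_⌝ i) (Vec.lookup∘tabulate ⌜_⌝ j)))

swap-descends : ∀ {N} (σ : Permutation′ N) {i j} → i Fin.< j → (σ ⟨$⟩ʳ i) Fin.< (σ ⟨$⟩ʳ j) →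
                weakBruhat · permPoint (swap i j σ) < weakBruhat · permPoint σ
swap-descends σ {i} {j} i<j σi<σj = <-+
  (flip-sign {x = ⌜ i ⌝} {⌜ j ⌝} (⌜ σ ⟨$⟩ʳ j ⌝ - ⌜ σ ⟨$⟩ʳ i ⌝) (·-swap-weak σ (Fin.<⇒≢ i<j)))
  (0<product (⌜⌝-mono σi<σj) (⌜⌝-mono i<j))
  where
  flip-sign : ∀ {s t x y} d → t ≡ s + d * (x - y) → s ≡ t + d * (y - x)
  flip-sign {s} {t} {x} {y} d refl = solve 4 (λ s d x y → s := s :+ d :* (x :- y) :+ d :* (y :- x)) refl s d x y

swap-ascends : ∀ {N} (σ : Permutation′ N) {i j} → i Fin.< j → (σ ⟨$⟩ʳ j) Fin.< (σ ⟨$⟩ʳ i) →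
               weakBruhat · permPoint σ < weakBruhat · permPoint (swap i j σ)
swap-ascends σ {i} {j} i<j σj<σi = <-+
  (trans (·-swap-weak σ (Fin.<⇒≢ i<j)) (cong (_+_ (weakBruhat · permPoint σ))
    (solve 4 (λ a b x y → (a :- b) :* (x :- y) := (b :- a) :* (y :- x)) refl ⌜ σ ⟨$⟩ʳ j ⌝ ⌜ σ ⟨$⟩ʳ i ⌝ ⌜ i ⌝ ⌜ j ⌝)))
  (0<product (⌜⌝-mono σj<σi) (⌜⌝-mono i<j))

lookup-permPoint : ∀ {N} (σ : Permutation′ N) l → lookup (permPoint σ) l ≡ ⌜ σ ⟨$⟩ʳ l ⌝
lookup-permPoint σ = Vec.lookup∘tabulate (λ i → ⌜ σ ⟨$⟩ʳ i ⌝)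

permPoint-< : ∀ {N} (σ : Permutation′ N) {i j} → (σ ⟨$⟩ʳ i) Fin.< (σ ⟨$⟩ʳ j) →
              lookup (permPoint σ) i < lookup (permPoint σ) j
permPoint-< σ lt = subst₂ _<_ (sym (lookup-permPoint σ _)) (sym (lookup-permPoint σ _)) (⌜⌝-mono lt)

permPoint-<⁻¹ : ∀ {N} (σ : Permutation′ N) {i j} → lookup (permPoint σ) i < lookup (permPoint σ) j →
                (σ ⟨$⟩ʳ i) Fin.< (σ ⟨$⟩ʳ j)
permPoint-<⁻¹ σ lt = ⌜⌝-cancel-< (subst₂ _<_ (lookup-permPoint σ _) (lookup-permPoint σ _) lt)

-- The sign of v - u along the line is read off the functional; it has to be
-- opposite to that of the swapped point.
line-inversion : ∀ {D G α β γ o₁ o₂ g₁ g₂ s u₁ u₂ v₁ v₂} → G ≡ g₁ - g₂ →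
  u₁ ≡ o₁ + α * g₁ → u₂ ≡ o₂ + α * g₂ →
  u₂ ≡ o₁ + β * g₁ → u₁ ≡ o₂ + β * g₂ →
  v₁ ≡ o₁ + γ * g₁ → v₂ ≡ o₂ + γ * g₂ →
  s + α * D < s + β * D → s + γ * D < s + α * D → u₂ < u₁ → v₂ < v₁
line-inversion {D} {G} {α} {β} {γ} {o₁} {o₂} {g₁} {g₂} {s} {u₁} {u₂} {v₁} {v₂} refl eu₁ eu₂ ew₁ ew₂ ev₁ ev₂ up down inv =
  0<q-p⇒p<q (subst (0ℚ <_) v-gap (ℚ.+-mono-< (p<q⇒0<q-p inv) opposite))
  where
  open ≡-Reasoning
  x = (β - α) * D
  y = (α - γ) * D
  z = (α - β) * G
  0<x : 0ℚ < x
  0<x = subst (0ℚ <_) (solve 4 (λ s α β D → s :+ β :* D :- (s :+ α :* D) := (β :- α) :* D) refl s α β D) (p<q⇒0<q-p up)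
  0<y : 0ℚ < y
  0<y = subst (0ℚ <_) (solve 4 (λ s α γ D → s :+ α :* D :- (s :+ γ :* D) := (α :- γ) :* D) refl s α γ D) (p<q⇒0<q-p down)
  z≡ : (u₁ - u₂) + (u₁ - u₂) ≡ z
  z≡ = begin
    (u₁ - u₂) + (u₁ - u₂)
      ≡⟨ solve 2 (λ a b → (a :- b) :+ (a :- b) := (a :- b) :- (b :- a)) refl u₁ u₂ ⟩
    (u₁ - u₂) - (u₂ - u₁)
      ≡⟨ cong₂ _-_ (cong₂ _-_ eu₁ eu₂) (cong₂ _-_ ew₁ ew₂) ⟩
    ((o₁ + α * g₁) - (o₂ + α * g₂)) - ((o₁ + β * g₁) - (o₂ + β * g₂))
      ≡⟨ solve 6 (λ o₁ o₂ g₁ g₂ α β → ((o₁ :+ α :* g₁) :- (o₂ :+ α :* g₂)) :- ((o₁ :+ β :* g₁) :- (o₂ :+ β :* g₂))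
            := (α :- β) :* (g₁ :- g₂)) refl o₁ o₂ g₁ g₂ α β ⟩
    z ∎
  0<z : 0ℚ < z
  0<z = subst (0ℚ <_) z≡ (ℚ.+-mono-< (p<q⇒0<q-p inv) (p<q⇒0<q-p inv))
  v-gap : (u₁ - u₂) + (γ - α) * G ≡ v₁ - v₂
  v-gap = begin
    (u₁ - u₂) + (γ - α) * G
      ≡⟨ cong (_+ (γ - α) * G) (cong₂ _-_ eu₁ eu₂) ⟩
    ((o₁ + α * g₁) - (o₂ + α * g₂)) + (γ - α) * (g₁ - g₂)
      ≡⟨ solve 6 (λ o₁ o₂ g₁ g₂ α γ → ((o₁ :+ α :* g₁) :- (o₂ :+ α :* g₂)) :+ (γ :- α) :* (g₁ :- g₂)
            := (o₁ :+ γ :* g₁) :- (o₂ :+ γ :* g₂)) refl o₁ o₂ g₁ g₂ α γ ⟩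
    (o₁ + γ * g₁) - (o₂ + γ * g₂)
      ≡⟨ cong₂ _-_ ev₁ ev₂ ⟨
    v₁ - v₂ ∎
  0<yz : 0ℚ < y * z
  0<yz = ℚ.positive⁻¹ (y * z) {{ℚ.pos*pos⇒pos y {{ℚ.positive 0<y}} z {{ℚ.positive 0<z}}}}
  -- `y * z` equals `x * ((γ - α) * G)`, so the positive factor x can be cancelled.
  opposite : 0ℚ < (γ - α) * G
  opposite = ℚ.*-cancelˡ-<-nonNeg x {{ℚ.nonNegative (ℚ.<⇒≤ 0<x)}}
    (subst₂ _<_ (sym (ℚ.*-zeroʳ x))
      (solve 5 (λ α β γ D G → ((α :- γ) :* D) :* ((α :- β) :* G) := ((β :- α) :* D) :* ((γ :- α) :* G)) refl α β γ D G)
      0<yz)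

PermutahedronFace : ℕ → Set
PermutahedronFace n = Face (OrientedPolytope.polytope (permutahedron n))

module _ {n : ℕ} where
  private
    N = suc n

    _≤W_ : Rel (Point N) 0ℓ
    _≤W_ = _≼_ (permutahedron n)

    carrierOf : Point N → Pred (Point N) 0ℓ
    carrierOf = Maximizers (ConvexHull PermPoint)

  face : ∀ {c r} → Levels c r → PermutahedronFace n
  face {c} {r} L = record { normal = c ; dim = r ; hasDim = levels⇒hasDim L }

  permPoint-vertex : ∀ σ → IsVertex (permutahedron n) (permPoint σ)
  permPoint-vertex σ = face vertex-levels , refl , monotone⇒maximizer σ (permPoint-<⁻¹ σ)
    where
    vertex-levels : Levels (permPoint σ) 0
    vertex-levels = record
      { rep            = λ i → i
      ; rep-level      = λ _ → refl
      ; rep-cong       = λ {i} {j} eq → σ-injective σ (⌜⌝-injective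
                           (trans (sym (lookup-permPoint σ i)) (trans eq (lookup-permPoint σ j))))
      ; free           = λ ()
      ; free-injective = λ { {()} }
      ; free≢rep       = λ ()
      ; free-complete  = λ i≢i → contradiction refl i≢i
      }

  vertex⇒permPoint : ∀ {v} → IsVertex (permutahedron n) v → PermPoint v
  vertex⇒permPoint {v} (F , dim≡0 , v∈F) = from-generator (generator∈F v∈F)
    where
    from-generator : ∃[ s ] PermPoint s × carrierOf (Face.normal F) s → PermPoint v
    from-generator (s , (σ , s≡σ) , s∈F) =
      σ , trans (dim0⇒unique (subst (HasDim (carrier F)) dim≡0 (Face.hasDim F)) v∈F s∈F) s≡σ

  -- If the normal separates i and j, both ends of the edge order them alike. If it ties them,
  -- swapping i and j in u stays on the edge and raises the functional; v is lower than u, so it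
  -- lies on the other side of u on the line, where the inversion only grows.
  arrow-inversion : ∀ {u v} → Arrow (permutahedron n) u v → ∀ {i j} → i Fin.< j → lookup u j < lookup u i → lookup v j < lookup v i
  arrow-inversion {u} {v} arrow {i} {j} i<j inv = go (vertex⇒permPoint u-vertex) (vertex⇒permPoint v-vertex)
    where
    open Arrow arrow
    c = Face.normal edge
    go : PermPoint u → PermPoint v → lookup v j < lookup v i
    go (σ , refl) (τ , refl) = by-normal (ℚ.<-cmp (lookup c i) (lookup c j))
      where
      by-normal : _ → lookup (permPoint τ) j < lookup (permPoint τ) i
      by-normal (tri< ci<cj _ _) = contradiction (maximizer-monotone {c = c} σ u∈edge ci<cj) (Fin.<-asym (permPoint-<⁻¹ σ inv))
      by-normal (tri> _ _ cj<ci) = permPoint-< τ (maximizer-monotone {c = c} τ v∈edge cj<ci)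
      by-normal (tri≈ _ ci≡cj _) =
          line-inversion {D = weakBruhat · direction} {α = proj₁ on-u} {β = proj₁ on-w} {γ = proj₁ on-v}
            {o₁ = lookup origin i} {lookup origin j} {lookup direction i} {lookup direction j}
            {weakBruhat · origin} refl
            (proj₂ on-u i) (proj₂ on-u j) (trans (sym wi) (proj₂ on-w i)) (trans (sym wj) (proj₂ on-w j))
            (proj₂ on-v i) (proj₂ on-v j)
            (subst₂ _<_ (height u {proj₁ on-u} (proj₂ on-u)) (height (permPoint w) {proj₁ on-w} (proj₂ on-w)) (swap-ascends σ i<j (permPoint-<⁻¹ σ inv)))
            (subst₂ _<_ (height v {proj₁ on-v} (proj₂ on-v)) (height u {proj₁ on-u} (proj₂ on-u)) decreasing)
            inv
        where
        open Line (dim1⇒line (subst (HasDim (carrier edge)) edge-dim (Face.hasDim edge)))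
        height = ·-line weakBruhat origin direction
        w = swap i j σ
        wi : lookup (permPoint w) i ≡ lookup (permPoint σ) j
        wi = trans (lookup-permPoint w i) (trans (cong ⌜_⌝ (swap-i σ i j)) (sym (lookup-permPoint σ j)))
        wj : lookup (permPoint w) j ≡ lookup (permPoint σ) i
        wj = trans (lookup-permPoint w j) (trans (cong ⌜_⌝ (swap-j σ i j)) (sym (lookup-permPoint σ i)))
        on-u = parameter u∈edge
        on-v = parameter v∈edge
        on-w = parameter (swap-maximizer σ (Fin.<⇒≢ i<j) ci≡cj u∈edge)

  ≼-inversion : ∀ {u v} → u ≤W v → ∀ {i j} → i Fin.< j → lookup u j < lookup u i → lookup v j < lookup v i
  ≼-inversion nil        i<j inv = inv
  ≼-inversion (a ◅ rest) i<j inv = ≼-inversion rest i<j (arrow-inversion a i<j inv)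

  ≼-descends : ∀ {u v} → u ≤W v → weakBruhat · v ≤ weakBruhat · u
  ≼-descends nil        = ℚ.≤-refl
  ≼-descends (a ◅ rest) = ℚ.≤-trans (≼-descends rest) (ℚ.<⇒≤ (Arrow.decreasing a))

-- The weak order and the order of faces

InversionsIncluded : ∀ {N} → Permutation′ N → Permutation′ N → Set
InversionsIncluded τ σ = ∀ {x y} → x Fin.< y → (τ ⟨$⟩ʳ y) Fin.< (τ ⟨$⟩ʳ x) → (σ ⟨$⟩ʳ y) Fin.< (σ ⟨$⟩ʳ x)

module AdjacentSwap {N} (τ : Permutation′ N) {i j} (i<j : i Fin.< j)
                    (adjacent : toℕ (τ ⟨$⟩ʳ j) ≡ suc (toℕ (τ ⟨$⟩ʳ i))) where

  i≢j : i ≢ j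
  i≢j = Fin.<⇒≢ i<j

  τi<τj : (τ ⟨$⟩ʳ i) Fin.< (τ ⟨$⟩ʳ j)
  τi<τj = ℕ.≤-reflexive (sym adjacent)

  above-i⇒above-j : ∀ {x} → x ≢ j → (τ ⟨$⟩ʳ i) Fin.< (τ ⟨$⟩ʳ x) → (τ ⟨$⟩ʳ j) Fin.< (τ ⟨$⟩ʳ x)
  above-i⇒above-j x≢j lt = ℕ.≤∧≢⇒< (ℕ.≤-trans (ℕ.≤-reflexive adjacent) lt)
    λ eq → x≢j (sym (σ-injective τ (Fin.toℕ-injective eq)))

  below-j⇒below-i : ∀ {y} → y ≢ i → (τ ⟨$⟩ʳ y) Fin.< (τ ⟨$⟩ʳ j) → (τ ⟨$⟩ʳ y) Fin.< (τ ⟨$⟩ʳ i)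
  below-j⇒below-i y≢i lt = ℕ.≤∧≢⇒< (ℕ.s≤s⁻¹ (ℕ.≤-trans lt (ℕ.≤-reflexive adjacent)))
    λ eq → y≢i (σ-injective τ (Fin.toℕ-injective eq))

  -- Since no value lies strictly between those of i and j, the pair (i , j) is the only new
  -- inversion; every other inversion after the swap comes from one of τ.
  swap-inversions : ∀ {σ} → InversionsIncluded τ σ → (σ ⟨$⟩ʳ j) Fin.< (σ ⟨$⟩ʳ i) → InversionsIncluded (swap i j τ) σ
  swap-inversions {σ} τ⊆σ σj<σi {x} {y} x<y inv = cases (x Fin.≟ i) (x Fin.≟ j) (y Fin.≟ i) (y Fin.≟ j)
    where
    cases : Dec (x ≡ i) → Dec (x ≡ j) → Dec (y ≡ i) → Dec (y ≡ j) → (σ ⟨$⟩ʳ y) Fin.< (σ ⟨$⟩ʳ x)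
    cases (yes refl) _ (yes refl) _ = contradiction x<y (Fin.<-irrefl refl)
    cases (yes refl) _ (no _) (yes refl) = σj<σi
    cases (yes refl) _ (no y≢i) (no y≢j) =
      τ⊆σ x<y (below-j⇒below-i y≢i (subst₂ Fin._<_ (swap-other τ i j y≢i y≢j) (swap-i τ i j) inv))
    cases (no _) (yes refl) (yes refl) _ = contradiction x<y (Fin.<-asym i<j)
    cases (no _) (yes refl) (no _) (yes refl) = contradiction x<y (Fin.<-irrefl refl)
    cases (no _) (yes refl) (no y≢i) (no y≢j) =
      τ⊆σ x<y (Fin.<-trans (subst₂ Fin._<_ (swap-other τ i j y≢i y≢j) (swap-j τ i j) inv) τi<τj)
    cases (no x≢i) (no x≢j) (yes refl) _ =
      τ⊆σ x<y (Fin.<-trans τi<τj (subst₂ Fin._<_ (swap-i τ i j) (swap-other τ i j x≢i x≢j) inv))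
    cases (no x≢i) (no x≢j) (no _) (yes refl) =
      τ⊆σ x<y (above-i⇒above-j x≢j (subst₂ Fin._<_ (swap-j τ i j) (swap-other τ i j x≢i x≢j) inv))
    cases (no x≢i) (no x≢j) (no y≢i) (no y≢j) =
      τ⊆σ x<y (subst₂ Fin._<_ (swap-other τ i j y≢i y≢j) (swap-other τ i j x≢i x≢j) inv)

  rep : Fin N → Fin N
  rep l = if does (l Fin.≟ j) then i else l

  rep-j : rep j ≡ i
  rep-j rewrite dec-true (j Fin.≟ j) refl = refl

  rep-other : ∀ {l} → l ≢ j → rep l ≡ l
  rep-other {l} l≢j rewrite dec-false (l Fin.≟ j) l≢j = refl

  -- Giving j the value of i merges two consecutive singletons into one part. The resulting face is
  -- the edge through τ and its swap.
  normal : Point N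
  normal = tabulate λ l → ⌜ τ ⟨$⟩ʳ rep l ⌝

  lookup-normal : ∀ l → lookup normal l ≡ ⌜ τ ⟨$⟩ʳ rep l ⌝
  lookup-normal = Vec.lookup∘tabulate (λ l → ⌜ τ ⟨$⟩ʳ rep l ⌝)

  normal-cong : ∀ {l m} → rep l ≡ rep m → lookup normal l ≡ lookup normal m
  normal-cong {l} {m} eq = trans (lookup-normal l) (trans (cong (λ x → ⌜ τ ⟨$⟩ʳ x ⌝) eq) (sym (lookup-normal m)))

  edge-levels : Levels normal 1
  edge-levels = record
    { rep            = rep
    ; rep-level      = λ l → normal-cong (idem l)
    ; rep-cong       = λ {l} {m} eq → σ-injective τ (⌜⌝-injective
                         (trans (sym (lookup-normal l)) (trans eq (lookup-normal m))))
    ; free           = λ _ → j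
    ; free-injective = λ { {zero} {zero} _ → refl }
    ; free≢rep       = λ _ eq → i≢j (trans (sym rep-j) eq)
    ; free-complete  = λ {l} → complete l
    }
    where
    idem : ∀ l → rep (rep l) ≡ rep l
    idem l with l Fin.≟ j
    ... | yes _  = rep-other i≢j
    ... | no l≢j = rep-other l≢j
    complete : ∀ l → rep l ≢ l → ∃[ a ] (λ (_ : Fin 1) → j) a ≡ l
    complete l l-free with l Fin.≟ j
    ... | yes l≡j = zero , sym l≡j
    ... | no  _   = contradiction refl l-free

  normal-monotone : Monotone normal τ
  normal-monotone {x} {y} lt = go (⌜⌝-cancel-< (subst₂ _<_ (lookup-normal x) (lookup-normal y) lt))
    where
    go : (τ ⟨$⟩ʳ rep x) Fin.< (τ ⟨$⟩ʳ rep y) → (τ ⟨$⟩ʳ x) Fin.< (τ ⟨$⟩ʳ y)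
    go lt with x Fin.≟ j | y Fin.≟ j
    ... | yes refl | yes refl = contradiction lt (Fin.<-irrefl refl)
    ... | yes refl | no y≢j   = above-i⇒above-j y≢j lt
    ... | no _     | yes refl = Fin.<-trans lt τi<τj
    ... | no _     | no _     = lt

module _ {n : ℕ} where
  private
    N = suc n

    _≤W_ : Rel (Point N) 0ℓ
    _≤W_ = _≼_ (permutahedron n)

  adjacent-arrow : ∀ τ {i j} → i Fin.< j → toℕ (τ ⟨$⟩ʳ j) ≡ suc (toℕ (τ ⟨$⟩ʳ i)) →
                   Arrow (permutahedron n) (permPoint τ) (permPoint (swap i j τ))
  adjacent-arrow τ {i} {j} i<j adjacent = record
    { edge       = face edge-levels
    ; edge-dim   = refl
    ; u-vertex   = permPoint-vertex τ
    ; v-vertex   = permPoint-vertex (swap i j τ)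
    ; u∈edge     = τ∈edge
    ; v∈edge     = swap-maximizer τ i≢j (normal-cong {i} {j} (trans (rep-other i≢j) (sym rep-j))) τ∈edge
    ; decreasing = swap-descends τ i<j τi<τj
    }
    where
    open AdjacentSwap τ i<j adjacent
    τ∈edge : Maximizers (ConvexHull PermPoint) normal (permPoint τ)
    τ∈edge = monotone⇒maximizer τ normal-monotone

  -- Each sorting step towards σ swaps a pair that σ orders oppositely to τ. Were j < i, that pair
  -- would be an inversion of τ missing from σ; so i < j, and the step is an arrow whose target
  -- still has its inversions among those of σ.
  inversions⇒≼ : ∀ (σ τ : Permutation′ N) → InversionsIncluded τ σ → permPoint τ ≤W permPoint σ
  inversions⇒≼ σ = sort-induction σ (λ τ → InversionsIncluded τ σ → permPoint τ ≤W permPoint σ)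
    (λ τ eq _ → subst (permPoint τ ≤W_) eq nil)
    λ τ i j adjacent σj<σi ih τ⊆σ → case ascending τ adjacent σj<σi τ⊆σ of λ i<j →
      adjacent-arrow τ i<j adjacent ◅ ih (AdjacentSwap.swap-inversions τ i<j adjacent {σ} τ⊆σ σj<σi)
    where
    ascending : ∀ τ {i j} → toℕ (τ ⟨$⟩ʳ j) ≡ suc (toℕ (τ ⟨$⟩ʳ i)) → (σ ⟨$⟩ʳ j) Fin.< (σ ⟨$⟩ʳ i) →
                InversionsIncluded τ σ → i Fin.< j
    ascending τ {i} {j} adjacent σj<σi τ⊆σ with Fin.<-cmp i j
    ... | tri< i<j _ _  = i<j
    ... | tri≈ _ refl _ = contradiction σj<σi (Fin.<-irrefl refl)
    ... | tri> _ _ j<i  = contradiction (τ⊆σ j<i (ℕ.≤-reflexive (sym adjacent))) (Fin.<-asym σj<σi)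

  -- F ≤ G for faces with normals c and d: along the chain every pair i < j goes
  -- from strictly ascending through at most one tie to strictly descending.
  Compatible : Rel (Point N) 0ℓ
  Compatible c d = ∀ i j → i Fin.< j → lookup c i < lookup c j ⊎ lookup d j < lookup d i

  compatible? : Binary.Decidable Compatible
  compatible? c d = Fin.all? λ i → Fin.all? λ j →
    (i Fin.<? j) →-dec ((lookup c i ℚ.<? lookup c j) ⊎-dec (lookup d j ℚ.<? lookup d i))

  module _ (F : PermutahedronFace n) where
    private
      c = Face.normal F

    top : Permutation′ N
    top = Top.sorted c

    bottom : Permutation′ N
    bottom = Bottom.sorted c

    top∈F : carrier F (permPoint top)
    top∈F = monotone⇒maximizer top (Top.sorted-monotone c)

    bottom∈F : carrier F (permPoint bottom)
    bottom∈F = monotone⇒maximizer bottom (Bottom.sorted-monotone c)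

    top-inversion : ∀ {i j} → i Fin.< j → lookup c j ≤ lookup c i → (top ⟨$⟩ʳ j) Fin.< (top ⟨$⟩ʳ i)
    top-inversion {i} {j} i<j cj≤ci with ℚ.<-cmp (lookup c j) (lookup c i)
    ... | tri< lt _ _ = Top.sorted-monotone c lt
    ... | tri≈ _ eq _ = Top.sorted-tie c eq i<j
    ... | tri> _ _ gt = <-≤-absurd gt cj≤ci

    bottom-inversion : ∀ {i j} → i Fin.< j → (bottom ⟨$⟩ʳ j) Fin.< (bottom ⟨$⟩ʳ i) → lookup c j < lookup c i
    bottom-inversion {i} {j} i<j inv with ℚ.<-cmp (lookup c j) (lookup c i)
    ... | tri< lt _ _ = lt
    ... | tri≈ _ eq _ = contradiction inv (Fin.<-asym (Bottom.sorted-tie c (sym eq) i<j))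
    ... | tri> _ _ gt = contradiction inv (Fin.<-asym (Bottom.sorted-monotone c gt))

    top-isTop : IsTop (permutahedron n) F (permPoint top)
    top-isTop = permPoint-vertex top , top∈F , λ v-vertex v∈F → below (vertex⇒permPoint v-vertex) v∈F
      where
      below : ∀ {v} → PermPoint v → carrier F v → v ≤W permPoint top
      below (ρ , refl) ρ∈F = inversions⇒≼ top ρ λ x<y inv →
        top-inversion x<y (ℚ.≮⇒≥ λ cx<cy → Fin.<-asym inv (maximizer-monotone {c = c} ρ ρ∈F cx<cy))

    bottom-isBottom : IsBottom (permutahedron n) F (permPoint bottom)
    bottom-isBottom = permPoint-vertex bottom , bottom∈F , λ v-vertex v∈F → above (vertex⇒permPoint v-vertex) v∈F
      where
      above : ∀ {v} → PermPoint v → carrier F v → permPoint bottom ≤W v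
      above (ρ , refl) ρ∈F = inversions⇒≼ ρ bottom λ x<y inv → maximizer-monotone {c = c} ρ ρ∈F (bottom-inversion x<y inv)

    -- A tied pair in its natural order at t could be swapped within F, giving a vertex with a lower
    -- value of the functional, although t is above all vertices of F and the functional descends
    -- along paths. This applies to any witness t without comparing it to `top`.
    isTop-inversion : ∀ {t} → IsTop (permutahedron n) F t → ∀ {i j} → i Fin.< j → lookup c j ≤ lookup c i → lookup t j < lookup t i
    isTop-inversion {t} (t-vertex , t∈F , t-max) {i} {j} i<j cj≤ci = go (vertex⇒permPoint t-vertex)
      where
      go : PermPoint t → lookup t j < lookup t i
      go (σ , refl) with Fin.<-cmp (σ ⟨$⟩ʳ j) (σ ⟨$⟩ʳ i)
      ... | tri< lt _ _ = permPoint-< σ lt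
      ... | tri≈ _ eq _ = contradiction (sym (σ-injective σ eq)) (Fin.<⇒≢ i<j)
      ... | tri> _ _ σi<σj = <-≤-absurd (swap-descends σ i<j σi<σj)
              (≼-descends (t-max (permPoint-vertex (swap i j σ)) (swap-maximizer σ (Fin.<⇒≢ i<j) (ℚ.≤-antisym ci≤cj cj≤ci) t∈F)))
        where
        ci≤cj : lookup c i ≤ lookup c j
        ci≤cj = ℚ.≮⇒≥ λ cj<ci → Fin.<-asym σi<σj (maximizer-monotone {c = c} σ t∈F cj<ci)

    isBottom-inversion : ∀ {b} → IsBottom (permutahedron n) F b → ∀ {i j} → i Fin.< j → lookup b j < lookup b i → lookup c j < lookup c i
    isBottom-inversion {b} (b-vertex , b∈F , b-min) {i} {j} i<j inv = go (vertex⇒permPoint b-vertex)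
      where
      go : PermPoint b → lookup c j < lookup c i
      go (ρ , refl) with ℚ.<-cmp (lookup c j) (lookup c i)
      ... | tri< lt _ _ = lt
      ... | tri> _ _ gt = contradiction (permPoint-<⁻¹ ρ inv) (Fin.<-asym (maximizer-monotone {c = c} ρ b∈F gt))
      ... | tri≈ _ eq _ = <-≤-absurd (swap-ascends ρ i<j (permPoint-<⁻¹ ρ inv))
              (≼-descends (b-min (permPoint-vertex (swap i j ρ)) (swap-maximizer ρ (Fin.<⇒≢ i<j) (sym eq) b∈F)))

  ≤ᶠ⇒compatible : ∀ F G → _≤ᶠ_ (permutahedron n) F G → Compatible (Face.normal F) (Face.normal G)
  ≤ᶠ⇒compatible F G (t , b , t-top , b-bottom , t≼b) i j i<j with lookup (Face.normal F) i ℚ.<? lookup (Face.normal F) j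
  ... | yes lt = inj₁ lt
  ... | no nlt = inj₂ (isBottom-inversion G b-bottom i<j (≼-inversion t≼b i<j (isTop-inversion F t-top i<j (ℚ.≮⇒≥ nlt))))

  compatible⇒≤ᶠ : ∀ F G → Compatible (Face.normal F) (Face.normal G) → _≤ᶠ_ (permutahedron n) F G
  compatible⇒≤ᶠ F G compatible =
    permPoint (top F) , permPoint (bottom G) , top-isTop F , bottom-isBottom G , inversions⇒≼ (bottom G) (top F) included
    where
    included : InversionsIncluded (top F) (bottom G)
    included {x} {y} x<y inv with compatible x y x<y
    ... | inj₁ cx<cy = contradiction (Top.sorted-monotone (Face.normal F) cx<cy) (Fin.<-asym inv)
    ... | inj₂ dy<dx = Bottom.sorted-monotone (Face.normal G) dy<dx

-- Minimum excess

levelNormal : ∀ {N p} → (Fin N → Fin p) → Point N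
levelNormal g = tabulate (⌜_⌝ ∘ g)

lookup-levelNormal : ∀ {N p} (g : Fin N → Fin p) i → lookup (levelNormal g) i ≡ ⌜ g i ⌝
lookup-levelNormal g = Vec.lookup∘tabulate (⌜_⌝ ∘ g)

-- A face depends only on the order pattern of its normal vector.
module _ {N} (c : Point N) where

  private
    _⊏_ : Rel (Fin N) 0ℓ
    i ⊏ j = lookup c i < lookup c j

    open Rank {_⊏_ = _⊏_} (λ i j → lookup c i ℚ.<? lookup c j) (ℚ.<-irrefl refl) ℚ.<-trans

  pattern-code : Vec (Fin N) N
  pattern-code = tabulate rank

  pattern-normal : Point N
  pattern-normal = levelNormal (lookup pattern-code)

  private
    lookup-normal : ∀ i → lookup pattern-normal i ≡ ⌜ rank i ⌝
    lookup-normal i = trans (lookup-levelNormal (lookup pattern-code) i) (cong ⌜_⌝ (Vec.lookup∘tabulate rank i))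

  pattern-< : ∀ {i j} → lookup c i < lookup c j → lookup pattern-normal i < lookup pattern-normal j
  pattern-< {i} {j} lt = subst₂ _<_ (sym (lookup-normal i)) (sym (lookup-normal j)) (⌜⌝-mono (rank-mono lt))

  pattern-≡ : ∀ {i j} → lookup c i ≡ lookup c j → lookup pattern-normal i ≡ lookup pattern-normal j
  pattern-≡ {i} {j} eq = trans (lookup-normal i)
    (trans (cong ⌜_⌝ (rank-cong (subst (_ <_) eq) (subst (_ <_) (sym eq)))) (sym (lookup-normal j)))

  pattern-≡⁻¹ : ∀ {i j} → lookup pattern-normal i ≡ lookup pattern-normal j → lookup c i ≡ lookup c j
  pattern-≡⁻¹ {i} {j} eq with ℚ.<-cmp (lookup c i) (lookup c j)
  ... | tri< lt _ _ = contradiction eq (ℚ.<⇒≢ (pattern-< lt))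
  ... | tri≈ _ e _  = e
  ... | tri> _ _ gt = contradiction (sym eq) (ℚ.<⇒≢ (pattern-< gt))

module _ (n : ℕ) where
  private
    N = suc n

  faceWithNormal : Point N → PermutahedronFace n
  faceWithNormal c = face (proj₂ (levels c))

  decode : Vec (Fin N) N → PermutahedronFace n
  decode τ = faceWithNormal (levelNormal (lookup τ))

  encode : PermutahedronFace n → Vec (Fin N) N
  encode F = pattern-code (Face.normal F)

  -- Both normals have the same level sets. The inequality points the right way for the search: a
  -- larger dimension lowers the excess.
  dim-decode-encode : ∀ F → Face.dim F ℕ.≤ Face.dim (decode (encode F))
  dim-decode-encode F = dim-≤ (Levels-resp {c = pattern-normal (Face.normal F)}
    (pattern-≡⁻¹ (Face.normal F)) (pattern-≡ (Face.normal F)) (proj₂ (levels _))) (Face.hasDim F)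

  surplus : ∀ {k} → Vec (PermutahedronFace n) k → ℤ
  surplus Fs = Vec.foldr′ ℤ._+_ (+ 0) (Vec.map (λ F → + Face.dim F ℤ.- + 1) Fs)

  surplus-decode-encode : ∀ {k} (Fs : Vec (PermutahedronFace n) k) → surplus Fs ℤ.≤ surplus (Vec.map decode (Vec.map encode Fs))
  surplus-decode-encode []       = ℤ.≤-refl
  surplus-decode-encode (F ∷ Fs) =
    ℤ.+-mono-≤ (ℤ.+-monoˡ-≤ (ℤ.- + 1) (ℤ.+≤+ (dim-decode-encode F))) (surplus-decode-encode Fs)

  CompatibleCodes : Rel (Vec (Fin N) N) 0ℓ
  CompatibleCodes τ ρ = Compatible (levelNormal (lookup τ)) (levelNormal (lookup ρ))

  encode-compatible : ∀ F G → _≤ᶠ_ (permutahedron n) F G → CompatibleCodes (encode F) (encode G)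
  encode-compatible F G F≤G i j i<j with ≤ᶠ⇒compatible F G F≤G i j i<j
  ... | inj₁ lt = inj₁ (pattern-< (Face.normal F) lt)
  ... | inj₂ gt = inj₂ (pattern-< (Face.normal G) gt)

  module _ {k : ℕ} where

    long-nontrivial : ∀ (Fs : Vec (PermutahedronFace n) (2 ℕ.+ k)) → ¬ Trivial (permutahedron n) Fs
    long-nontrivial (_ ∷ _ ∷ _) ()

    chain : (τs : Vec (Vec (Fin N) N) (2 ℕ.+ k)) → Linked CompatibleCodes τs → FaceChain (permutahedron n) (2 ℕ.+ k)
    chain τs linked = record
      { faces      = Vec.map decode τs
      ; ascending  = Linked.map⁺ (Linked.map (λ {τ} {ρ} → compatible⇒≤ᶠ (decode τ) (decode ρ)) linked)
      ; nontrivial = long-nontrivial (Vec.map decode τs)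
      }

    minimum-excess : ∃[ e ] IsMinimumExcess (permutahedron n) (2 ℕ.+ k) e
    minimum-excess = value best , (chain best best-linked , refl) , λ 𝐅 →
        ℤ.≤-trans (ListAll.lookup (f[argmin]≤f[xs] {f = value} trivialCodes candidates)
                    (∈-filter⁺ linked? (∈-allVecs (∈-allVecs ∈-allFin) (Vec.map encode (FaceChain.faces 𝐅))) (encode-linked 𝐅)))
                  (ℤ.+-monoʳ-≤ (+ n ℤ.- + 1) (ℤ.neg-mono-≤ (surplus-decode-encode (FaceChain.faces 𝐅))))
      where
      open Extrema ℤ.≤-totalOrder
      value : Vec (Vec (Fin N) N) (2 ℕ.+ k) → ℤ
      value τs = (+ n ℤ.- + 1) ℤ.- surplus (Vec.map decode τs)
      linked? : Decidable (Linked CompatibleCodes)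
      linked? = Linked.linked? λ τ ρ → compatible? (levelNormal (lookup τ)) (levelNormal (lookup ρ))
      candidates = List.filter linked? (allVecs (allVecs (List.allFin N) N) (2 ℕ.+ k))
      -- `argmin` needs a default candidate: the chain that repeats the bottom vertex of the
      -- permutahedron.
      identity : Vec (Fin N) N
      identity = tabulate (λ i → i)
      identity-compatible : CompatibleCodes identity identity
      identity-compatible i j i<j = inj₁ (subst₂ _<_ (sym (lookup-identity i)) (sym (lookup-identity j)) (⌜⌝-mono i<j))
        where
        lookup-identity : ∀ i → lookup (levelNormal (lookup identity)) i ≡ ⌜ i ⌝
        lookup-identity i = trans (lookup-levelNormal (lookup identity) i) (cong ⌜_⌝ (Vec.lookup∘tabulate (λ i → i) i))
      trivialCodes : Vec (Vec (Fin N) N) (2 ℕ.+ k)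
      trivialCodes = replicate (2 ℕ.+ k) identity
      trivial-linked : ∀ m → Linked CompatibleCodes (replicate m identity)
      trivial-linked zero          = []
      trivial-linked (suc zero)    = [-]
      trivial-linked (suc (suc m)) = identity-compatible ∷ trivial-linked (suc m)
      best = argmin value trivialCodes candidates
      best-linked : Linked CompatibleCodes best
      best-linked = argmin-all value {xs = candidates} (trivial-linked (2 ℕ.+ k))
        (ListAll.all-filter linked? (allVecs (allVecs (List.allFin N) N) (2 ℕ.+ k)))
      encode-linked : (𝐅 : FaceChain (permutahedron n) (2 ℕ.+ k)) → Linked CompatibleCodes (Vec.map encode (FaceChain.faces 𝐅))
      encode-linked 𝐅 = Linked.map⁺ (Linked.map (λ {F} {G} → encode-compatible F G) (FaceChain.ascending 𝐅))

-- Dimension against the number of levels, and chains of length one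

module _ {N r} {c : Point N} (L : Levels c r) where
  open Levels L

  -- The free indices and the representatives of p different levels are distinct elements of
  -- `Fin N`.
  free+levels≤N : ∀ {p} (l : Fin p → Fin N) → (∀ {a b} → lookup c (l a) ≡ lookup c (l b) → a ≡ b) → r ℕ.+ p ℕ.≤ N
  free+levels≤N {p} l l-inj = Fin.injective⇒≤ {f = choose ∘ splitAt r} λ {x} {y} eq →
    trans (sym (Fin.join-splitAt r p x)) (trans (cong (join r p) (choose-injective (splitAt r x) (splitAt r y) eq)) (Fin.join-splitAt r p y))
    where
    choose : Fin r ⊎ Fin p → Fin N
    choose = [ free , rep ∘ l ]′
    free≢rep-l : ∀ a b → free a ≢ rep (l b)
    free≢rep-l a b eq = free≢rep a (trans (cong rep eq) (trans (rep-idem (l b)) (sym eq)))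
    choose-injective : ∀ x y → choose x ≡ choose y → x ≡ y
    choose-injective (inj₁ a) (inj₁ b) eq = cong inj₁ (free-injective eq)
    choose-injective (inj₁ a) (inj₂ b) eq = contradiction eq (free≢rep-l a b)
    choose-injective (inj₂ a) (inj₁ b) eq = contradiction (sym eq) (free≢rep-l b a)
    choose-injective (inj₂ a) (inj₂ b) eq = cong inj₂ (l-inj
      (trans (sym (rep-level (l a))) (trans (cong (lookup c) eq) (rep-level (l b)))))

  -- An index that is not free is the representative of its level, hence determined by its value
  -- under g.
  N≤free+levels : ∀ {p} (g : Fin N → Fin p) → (∀ {i j} → g i ≡ g j → lookup c i ≡ lookup c j) → N ℕ.≤ r ℕ.+ p
  N≤free+levels {p} g g-level = Fin.injective⇒≤ {f = join r p ∘ classify} λ {i} {j} eq →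
    separate i j (trans (sym (Fin.splitAt-join r p (classify i))) (trans (cong (splitAt r) eq) (Fin.splitAt-join r p (classify j))))
    where
    classify : Fin N → Fin r ⊎ Fin p
    classify i with rep i Fin.≟ i
    ... | yes _      = inj₂ (g i)
    ... | no  i-free = inj₁ (proj₁ (free-complete i-free))
    separate : ∀ i j → classify i ≡ classify j → i ≡ j
    separate i j eq with rep i Fin.≟ i | rep j Fin.≟ j
    separate i j eq | yes i-rep  | yes j-rep  = trans (sym i-rep) (trans (rep-cong (g-level (inj₂-injective eq))) j-rep)
    separate i j eq | no  i-free | no  j-free = trans (sym (proj₂ (free-complete i-free)))
      (trans (cong free (inj₁-injective eq)) (proj₂ (free-complete j-free)))
    separate i j () | yes _ | no _
    separate i j () | no _  | yes _

-- Every permutation is vacuously monotone for a constant c, so the rearrangement inequality holds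
-- in both directions. For k = 1 this recognises the excluded trivial chain.
constant-normal : ∀ {N} (c : Point N) → (∀ i j → lookup c i ≡ lookup c j) →
                  ∀ {p} → ConvexHull PermPoint p → Maximizers (ConvexHull PermPoint) c p
constant-normal {N} c const {p} p∈P = p∈P , λ q∈P → ℚ.≤-reflexive (trans (value q∈P) (sym (value p∈P)))
  where
  never : ∀ {i j} → ¬ lookup c i < lookup c j
  never = ℚ.<-irrefl (const _ _)
  generator-value : ∀ {s} → PermPoint s → c · s ≡ c · permPoint idₚ
  generator-value (σ , refl) = ℚ.≤-antisym
    (rearrangement c idₚ (λ lt → contradiction lt never) σ) (rearrangement c σ (λ lt → contradiction lt never) idₚ)
  value : ∀ {q} → ConvexHull PermPoint q → c · q ≡ c · permPoint idₚ
  value q∈P = hull-≡ c q∈P λ i _ → generator-value (ConvexHull.points∈S q∈P i)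

module _ (n : ℕ) where
  face-dim-≤ : (F : PermutahedronFace n) → Face.dim F ℕ.≤ n
  face-dim-≤ F = ℕ.≤-trans (dim-≤ (proj₂ (levels c)) (Face.hasDim F)) (ℕ.s≤s⁻¹
    (ℕ.≤-trans (ℕ.≤-reflexive (ℕ.+-comm 1 _)) (free+levels≤N (proj₂ (levels c)) {1} (λ _ → zero) λ { {zero} {zero} _ → refl })))
    where
    c = Face.normal F

  proper-face-dim-< : (F : PermutahedronFace n) → ∀ {i j} → lookup (Face.normal F) i ≢ lookup (Face.normal F) j → Face.dim F ℕ.< n
  proper-face-dim-< F {i} {j} ci≢cj = ℕ.s≤s⁻¹ (ℕ.≤-trans (ℕ.s≤s (ℕ.s≤s (dim-≤ (proj₂ (levels c)) (Face.hasDim F))))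
    (ℕ.≤-trans (ℕ.≤-reflexive (ℕ.+-comm 2 _)) (free+levels≤N (proj₂ (levels c)) l l-inj)))
    where
    c = Face.normal F
    l : Fin 2 → Fin (suc n)
    l zero    = i
    l (suc _) = j
    l-inj : ∀ {a b} → lookup c (l a) ≡ lookup c (l b) → a ≡ b
    l-inj {zero}     {zero}     _  = refl
    l-inj {zero}     {suc zero} eq = contradiction eq ci≢cj
    l-inj {suc zero} {zero}     eq = contradiction (sym eq) ci≢cj
    l-inj {suc zero} {suc zero} _  = refl

module _ (m : ℕ) where
  private
    class : Fin (suc (suc m)) → Fin (suc (suc m))
    class zero    = zero
    class (suc _) = suc zero

    lookup-class = lookup-levelNormal class

    facet-levels : Levels (levelNormal class) m
    facet-levels = record
      { rep            = class
      ; rep-level      = λ i → trans (lookup-class (class i)) (trans (cong ⌜_⌝ (idem i)) (sym (lookup-class i)))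
      ; rep-cong       = λ {i} {j} eq → ⌜⌝-injective (trans (sym (lookup-class i)) (trans eq (lookup-class j)))
      ; free           = λ a → suc (suc a)
      ; free-injective = Fin.suc-injective ∘ Fin.suc-injective
      ; free≢rep       = λ _ ()
      ; free-complete  = λ { {zero}        i-free → contradiction refl i-free
                            ; {suc zero}    i-free → contradiction refl i-free
                            ; {suc (suc a)} _      → a , refl }
      }
      where
      idem : ∀ i → class (class i) ≡ class i
      idem zero    = refl
      idem (suc _) = refl

    facet : FaceChain (permutahedron (suc m)) 1
    facet = record
      { faces      = face facet-levels ∷ []
      ; ascending  = [-]
      -- The facet forces the coordinate at `zero` to be below all others; exchanging the first two
      -- values gives a vertex outside of it.
      ; nontrivial = λ P⊆F → contradiction
          (maximizer-monotone σ (P⊆F (perm∈P σ)) {zero} {suc zero}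
            (subst₂ _<_ (sym (lookup-class zero)) (sym (lookup-class (suc zero))) (⌜⌝-mono {suc (suc m)} {zero} {suc zero} (ℕ.s≤s ℕ.z≤n))))
          λ ()
      }
      where
      σ : Permutation′ (suc (suc m))
      σ = swap zero (suc zero) idₚ

    facet-excess : ∀ x → ((+ 1 ℤ.+ x) ℤ.- + 1) ℤ.- ((x ℤ.- + 1) ℤ.+ + 0) ≡ + 1
    facet-excess = solve-∀

    facet-minimal : (𝐅 : FaceChain (permutahedron (suc m)) 1) → + 1 ℤ.≤ excess (permutahedron (suc m)) 𝐅
    facet-minimal record { faces = F ∷ [] ; nontrivial = nontrivial }
      with Fin.any? (λ i → ¬? (lookup (Face.normal F) i ℚ.≟ lookup (Face.normal F) zero))
    ... | yes (i , ci≢c₀) = ℤ.≤-trans (ℤ.≤-reflexive (sym (facet-excess (+ m))))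
            (ℤ.+-monoʳ-≤ (+ suc m ℤ.- + 1) (ℤ.neg-mono-≤ (ℤ.+-monoˡ-≤ (+ 0) (ℤ.+-monoˡ-≤ (ℤ.- + 1)
              (ℤ.+≤+ (ℕ.s≤s⁻¹ (proper-face-dim-< (suc m) F ci≢c₀)))))))
    ... | no  none = contradiction (λ {p} p∈P → constant-normal (Face.normal F) (λ i j → trans (same i) (sym (same j))) p∈P) nontrivial
      where
      same : ∀ i → lookup (Face.normal F) i ≡ lookup (Face.normal F) zero
      same i with lookup (Face.normal F) i ℚ.≟ lookup (Face.normal F) zero
      ... | yes eq = eq
      ... | no neq = contradiction (i , neq) none

  minimum-excess-1 : IsMinimumExcess (permutahedron (suc m)) 1 (+ 1)
  minimum-excess-1 = (facet , facet-excess (+ m)) , facet-minimal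

-- Asymptotics

module _ (n : ℕ) where

  surplus-≤ : ∀ {k} (Fs : Vec (PermutahedronFace n) k) → surplus n Fs ℤ.≤ + k ℤ.* (+ n ℤ.- + 1)
  surplus-≤ []                   = ℤ.≤-refl
  surplus-≤ {suc k} (F ∷ Fs) = ℤ.≤-trans
    (ℤ.+-mono-≤ (ℤ.+-monoˡ-≤ (ℤ.- + 1) (ℤ.+≤+ (face-dim-≤ n F))) (surplus-≤ Fs))
    (ℤ.≤-reflexive (sym (ℤ.suc-* (+ k) (+ n ℤ.- + 1))))

-- With i = x M + y, the faces have the levels b x + (M - y) for decreasing b.
-- Every pair of points (x , y) is tied for at most one slope b.
module Fan (n m : ℕ) where
  private
    M = suc m
    q = n ℕ./ M

  levelBound : ℕ → ℕ
  levelBound b = suc (b ℕ.* q ℕ.+ M)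

  private
    x y : Fin (suc n) → ℕ
    x i = toℕ i ℕ./ M
    y i = toℕ i ℕ.% M

    -- The subtraction never truncates, as y < M. Its sign makes indices with equal x descend for
    -- every b.
    value : ℕ → Fin (suc n) → ℕ
    value b i = b ℕ.* x i ℕ.+ (M ℕ.∸ y i)

    value-bound : ∀ b i → value b i ℕ.< levelBound b
    value-bound b i = ℕ.s≤s (ℕ.+-mono-≤ (ℕ.*-monoʳ-≤ b (ℕ./-monoˡ-≤ M (ℕ.s≤s⁻¹ (Fin.toℕ<n i)))) (ℕ.m∸n≤m M (y i)))

    class : ∀ b → Fin (suc n) → Fin (levelBound b)
    class b i = fromℕ< (value-bound b i)

    normal : ℕ → Point (suc n)
    normal b = levelNormal (class b)

    normal-< : ∀ b {i j} → value b i ℕ.< value b j → lookup (normal b) i < lookup (normal b) j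
    normal-< b {i} {j} lt = subst₂ _<_ (sym (lookup-levelNormal (class b) i)) (sym (lookup-levelNormal (class b) j))
      (⌜⌝-mono (subst₂ ℕ._<_ (sym (Fin.toℕ-fromℕ< (value-bound b i))) (sym (Fin.toℕ-fromℕ< (value-bound b j))) lt))

    value-suc : ∀ b i → value (suc b) i ≡ x i ℕ.+ value b i
    value-suc b i = ℕ.+-assoc (x i) (b ℕ.* x i) (M ℕ.∸ y i)

    same-x⇒y< : ∀ {i j} → i Fin.< j → x i ≡ x j → y i ℕ.< y j
    same-x⇒y< {i} {j} i<j xi≡xj = ℕ.+-cancelʳ-< (x i ℕ.* M) (y i) (y j)
      (subst₂ ℕ._<_ (ℕ.m≡m%n+[m/n]*n (toℕ i) M)
        (trans (ℕ.m≡m%n+[m/n]*n (toℕ j) M) (cong (λ z → y j ℕ.+ z ℕ.* M) (sym xi≡xj))) i<j)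

    -- Passing from b to b + 1 adds x. If x i < x j and the pair is not ascending for b + 1,
    -- removing x from both sides turns the weak inequality into a strict descent for b. If x i = x
    -- j, then y i < y j and the pair descends for b anyway.
    fan-compatible : ∀ b → Compatible {n} (normal (suc b)) (normal b)
    fan-compatible b i j i<j with value (suc b) i ℕ.<? value (suc b) j | x i ℕ.≟ x j
    ... | yes lt | _         = inj₁ (normal-< (suc b) {i} {j} lt)
    ... | no nlt | no xi≢xj = inj₂ (normal-< b {j} {i} (ℕ.+-cancelˡ-< (x i) (value b j) (value b i) (ℕ.<-≤-trans
            (ℕ.+-monoˡ-< (value b j) (ℕ.≤∧≢⇒< (ℕ./-monoˡ-≤ M (ℕ.<⇒≤ i<j)) xi≢xj))
            (subst₂ ℕ._≤_ (value-suc b j) (value-suc b i) (ℕ.≮⇒≥ nlt)))))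
    ... | no nlt | yes xi≡xj = inj₂ (normal-< b {j} {i} (subst (λ z → b ℕ.* z ℕ.+ (M ℕ.∸ y j) ℕ.< value b i) xi≡xj
            (ℕ.+-monoʳ-< (b ℕ.* x i) (ℕ.∸-monoʳ-< (same-x⇒y< {i} {j} i<j xi≡xj) (ℕ.<⇒≤ (ℕ.m%n<n (toℕ j) M))))))

  fanFaces : ∀ k → Vec (PermutahedronFace n) k
  fanFaces zero    = []
  fanFaces (suc b) = faceWithNormal n (normal (suc b)) ∷ fanFaces b

  fan-linked : ∀ k → Linked (_≤ᶠ_ (permutahedron n)) (fanFaces k)
  fan-linked zero          = []
  fan-linked (suc zero)    = [-]
  fan-linked (suc (suc b)) =
    compatible⇒≤ᶠ (faceWithNormal n (normal (suc (suc b)))) (faceWithNormal n (normal (suc b))) (fan-compatible (suc b))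
    ∷ fan-linked (suc b)

  private
    -- The bound is taken at the largest slope K, so that all faces of the chain share it and the
    -- surplus is a plain multiple.
    fan-dim : ∀ {K} b → b ℕ.≤ K → + n ℤ.- + levelBound K ℤ.≤ + Face.dim (faceWithNormal n (normal b)) ℤ.- + 1
    fan-dim {K} b b≤K = subst₂ ℤ._≤_ (lhs (+ n) (+ p)) (rhs (+ r) (+ p))
        (ℤ.+-monoˡ-≤ (ℤ.- (+ p ℤ.+ + 1)) (ℤ.+≤+ N≤r+p))
      where
      c = normal b
      r = proj₁ (levels c)
      p = levelBound K
      N≤r+p : suc n ℕ.≤ r ℕ.+ p
      N≤r+p = ℕ.≤-trans (N≤free+levels (proj₂ (levels c)) (class b) λ {i} {j} eq →
          trans (lookup-levelNormal (class b) i) (trans (cong ⌜_⌝ eq) (sym (lookup-levelNormal (class b) j))))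
        (ℕ.+-monoʳ-≤ r (ℕ.s≤s (ℕ.+-monoˡ-≤ M (ℕ.*-monoˡ-≤ q b≤K))))
      lhs : ∀ n p → (+ 1 ℤ.+ n) ℤ.- (p ℤ.+ + 1) ≡ n ℤ.- p
      lhs = solve-∀
      rhs : ∀ r p → (r ℤ.+ p) ℤ.- (p ℤ.+ + 1) ≡ r ℤ.- + 1
      rhs = solve-∀

  fan-surplus : ∀ {K} k → k ℕ.≤ K → + k ℤ.* (+ n ℤ.- + levelBound K) ℤ.≤ surplus n (fanFaces k)
  fan-surplus     zero    _   = ℤ.≤-refl
  fan-surplus {K} (suc k) k<K = ℤ.≤-trans (ℤ.≤-reflexive (ℤ.suc-* (+ k) (+ n ℤ.- + levelBound K)))
    (ℤ.+-mono-≤ (fan-dim (suc k) k<K) (fan-surplus k (ℕ.<⇒≤ k<K)))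

∣∣-≤ : ∀ {z B} → ℤ.- + B ℤ.≤ z → z ℤ.≤ + B → ℤ.∣ z ∣ ℕ.≤ B
∣∣-≤ {+ _}      _     upper = ℤ.drop‿+≤+ upper
∣∣-≤ { -[1+ _ ]} lower _     = ℤ.drop‿+≤+ (ℤ.neg-cancel-≤ lower)

module _ (k n : ℕ) where
  private
    K = 2 ℕ.+ k
    min = minimum-excess n {k}
    e = proj₁ min

  excess-deviation : ∀ m → ℤ.∣ e ℤ.- E K n ∣ ℕ.≤ K ℕ.* Fan.levelBound n m K
  excess-deviation m = ∣∣-≤ lower upper
    where
    open Fan n m
    p = levelBound K
    fan : FaceChain (permutahedron n) K
    fan = record { faces = fanFaces K ; ascending = fan-linked K ; nontrivial = long-nontrivial n (fanFaces K) }
    e≤fan : e ℤ.≤ (+ n ℤ.- + 1) ℤ.- + K ℤ.* (+ n ℤ.- + p)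
    e≤fan = ℤ.≤-trans (proj₂ (proj₂ min) fan) (ℤ.+-monoʳ-≤ (+ n ℤ.- + 1) (ℤ.neg-mono-≤ (fan-surplus K ℕ.≤-refl)))
    -- The fan differs from `E K n` by exactly K p - 2 K, of which 2 K is dropped.
    upper : e ℤ.- E K n ℤ.≤ + (K ℕ.* p)
    upper = ℤ.≤-trans (ℤ.+-monoˡ-≤ (ℤ.- E K n) e≤fan) (ℤ.≤-trans (ℤ.≤-reflexive (identity (+ n) (+ K) (+ p)))
      (ℤ.≤-trans (ℤ.i≤j⇒i-k≤j (+ K) (ℤ.i≤j⇒i-k≤j (+ K) ℤ.≤-refl)) (ℤ.≤-reflexive (sym (ℤ.pos-* K p)))))
      where
      identity : ∀ n k p → ((n ℤ.- + 1) ℤ.- k ℤ.* (n ℤ.- p)) ℤ.- ((n ℤ.- + 1) ℤ.- k ℤ.* (n ℤ.- + 2)) ≡ k ℤ.* p ℤ.- k ℤ.- k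
      identity = solve-∀
    lower : ℤ.- + (K ℕ.* p) ℤ.≤ e ℤ.- E K n
    -- Replacing n - 2 by the largest possible n - 1 in each of the K terms loses K, and K is at
    -- most K p because p is a successor.
    lower = ℤ.≤-trans (ℤ.neg-mono-≤ (ℤ.+≤+ (ℕ.m≤m*n K p))) (ℤ.≤-trans (ℤ.≤-reflexive (sym (identity (+ n) (+ K))))
      (ℤ.+-monoˡ-≤ (ℤ.- E K n) (attained (proj₁ (proj₂ min)))))
      where
      identity : ∀ n k → ((n ℤ.- + 1) ℤ.- k ℤ.* (n ℤ.- + 1)) ℤ.- ((n ℤ.- + 1) ℤ.- k ℤ.* (n ℤ.- + 2)) ≡ ℤ.- k
      identity = solve-∀
      attained : Σ[ 𝐅 ∈ FaceChain (permutahedron n) K ] excess (permutahedron n) 𝐅 ≡ e →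
                 (+ n ℤ.- + 1) ℤ.- + K ℤ.* (+ n ℤ.- + 1) ℤ.≤ e
      attained (𝐅 , eq) = ℤ.≤-trans (ℤ.+-monoʳ-≤ (+ n ℤ.- + 1) (ℤ.neg-mono-≤ (surplus-≤ n (FaceChain.faces 𝐅)))) (ℤ.≤-reflexive eq)

-- With n = n' + 2, minus `E` is (k + 1) n' - 1; the constant 3 collects the shift by 2 and this 1.
E-large : ∀ k n → 2 ℕ.≤ n → n ℕ.≤ 3 ℕ.+ ℤ.∣ E (2 ℕ.+ k) n ∣
E-large k (suc (suc n)) (ℕ.s≤s (ℕ.s≤s ℕ.z≤n)) = ℕ.s≤s (ℕ.s≤s (ℕ.≤-trans (ℕ.m≤n*m n (suc k)) (ℤ.drop‿+≤+ bound)))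
  where
  identity : ∀ n k → (+ 1 ℤ.+ k) ℤ.* n ≡ + 1 ℤ.+ ℤ.- ((+ 2 ℤ.+ n ℤ.- + 1) ℤ.- (+ 2 ℤ.+ k) ℤ.* (+ 2 ℤ.+ n ℤ.- + 2))
  identity = solve-∀
  i≤∣i∣ : ∀ i → i ℤ.≤ + ℤ.∣ i ∣
  i≤∣i∣ (+ _)    = ℤ.≤-refl
  i≤∣i∣ -[1+ _ ] = ℤ.-≤+
  bound : + (suc k ℕ.* n) ℤ.≤ + 1 ℤ.+ + ℤ.∣ E (2 ℕ.+ k) (2 ℕ.+ n) ∣
  bound = ℤ.≤-trans (ℤ.≤-reflexive (trans (ℤ.pos-* (suc k) n) (identity (+ n) (+ k))))
    (ℤ.+-monoʳ-≤ (+ 1) (ℤ.≤-trans (i≤∣i∣ (ℤ.- E (2 ℕ.+ k) (2 ℕ.+ n))) (ℤ.≤-reflexive (cong +_ (ℤ.∣-i∣≡∣i∣ (E (2 ℕ.+ k) (2 ℕ.+ n)))))))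

-- With M = 2 b K² + 1 (b the denominator of ε) the n / M part of the deviation
-- is at most half of n.
deviation-small : ∀ b K q n m → m ≡ 2 ℕ.* (b ℕ.* (K ℕ.* K)) → q ℕ.* suc m ℕ.≤ n →
  8 ℕ.+ 2 ℕ.* (b ℕ.* (K ℕ.* suc (suc m))) ℕ.≤ n → 3 ℕ.+ b ℕ.* (K ℕ.* suc (K ℕ.* q ℕ.+ suc m)) ℕ.< n
deviation-small b K q n m refl qM≤n large = ℕ.*-cancelˡ-< 2 _ n (begin-strict
  2 ℕ.* (3 ℕ.+ b ℕ.* (K ℕ.* suc (K ℕ.* q ℕ.+ suc m)))
    ≡⟨ identity b K q m ⟩
  (6 ℕ.+ 2 ℕ.* (b ℕ.* (K ℕ.* suc (suc m)))) ℕ.+ q ℕ.* (2 ℕ.* (b ℕ.* (K ℕ.* K)))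
    -- The terms without q are below n by the threshold; the others amount to q m, at most q (m + 1)
    -- and hence at most n.
    <⟨ ℕ.+-mono-<-≤ (ℕ.≤-trans (ℕ.n≤1+n _) large) (ℕ.≤-trans (ℕ.*-monoʳ-≤ q (ℕ.n≤1+n m)) qM≤n) ⟩
  n ℕ.+ n
    ≡⟨ cong (n ℕ.+_) (sym (ℕ.+-identityʳ n)) ⟩
  2 ℕ.* n ∎)
  where
  open ℕ.≤-Reasoning
  identity : ∀ b K q m → 2 ℕ.* (3 ℕ.+ b ℕ.* (K ℕ.* suc (K ℕ.* q ℕ.+ suc m)))
                       ≡ (6 ℕ.+ 2 ℕ.* (b ℕ.* (K ℕ.* suc (suc m)))) ℕ.+ q ℕ.* (2 ℕ.* (b ℕ.* (K ℕ.* K)))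
  identity = ℕ.solve-∀

-- A positive ε with denominator b is at least 1 / b. If the ratio r were ε or more away from 1,
-- then |d| would be at most b |r - 1| |d| = b |a - d|. The strict hypothesis also makes d nonzero,
-- so that the ratio is defined.
ratio-close : ∀ a d {ε} → 0ℚ < ε → ℚ.denominatorℕ ε ℕ.* ℤ.∣ a ℤ.- d ∣ ℕ.< ℤ.∣ d ∣ →
              ∃[ r ] Ratio a d r × ∣ r - 1ℚ ∣ < ε
ratio-close a d {ε@(ℚ.mkℚ +[1+ m ] b-1 c)} 0<ε close = r , (nz , refl) , ℚ.≰⇒> not-far
  where
  b = suc b-1
  d≢0 : d ≢ + 0
  d≢0 refl = contradiction close λ ()
  nz : ℚ.NonZero (d / 1)
  nz = ℚ.≢-nonZero λ eq → d≢0 (cong ℚ.numerator (trans (sym (/1≡ι d)) eq))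
  r = ((a / 1) ÷ (d / 1)) {{nz}}
  scaled : (r - 1ℚ) * ι d ≡ ι (a ℤ.- d)
  scaled = begin
    (r - 1ℚ) * ι d
      ≡⟨ cong ((r - 1ℚ) *_) (/1≡ι d) ⟨
    (r - 1ℚ) * (d / 1)
      ≡⟨ solve 3 (λ a i d → (a :* i :- con 1ℚ) :* d := a :* (i :* d) :- d) refl (a / 1) ((1/ (d / 1)) {{nz}}) (d / 1) ⟩
    (a / 1) * ((1/ (d / 1)) {{nz}} * (d / 1)) - (d / 1)
      ≡⟨ cong (λ x → (a / 1) * x - (d / 1)) (ℚ.*-inverseˡ (d / 1) {{nz}}) ⟩
    (a / 1) * 1ℚ - (d / 1)
      ≡⟨ cong (_- (d / 1)) (ℚ.*-identityʳ (a / 1)) ⟩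
    (a / 1) - (d / 1)
      ≡⟨ cong₂ _-_ (/1≡ι a) (/1≡ι d) ⟩
    ι a - ι d
      ≡⟨ cong (_+_ (ι a)) (ι-neg d) ⟩
    ι a + ι (ℤ.- d)
      ≡⟨ ι-+ a (ℤ.- d) ⟩
    ι (a ℤ.- d) ∎
    where open ≡-Reasoning
  ∣scaled∣ : ∣ r - 1ℚ ∣ * ι (+ ℤ.∣ d ∣) ≡ ι (+ ℤ.∣ a ℤ.- d ∣)
  ∣scaled∣ = trans (sym (ℚ.∣p*q∣≡∣p∣*∣q∣ (r - 1ℚ) (ι d))) (cong ∣_∣ scaled)
  1≤bε : 1ℚ ≤ ι (+ b) * ε
  1≤bε = ℚ.≤-trans (ℚ.≤-reflexive (sym (ℚ.*-inverseʳ (ι (+ b)))))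
    (ℚ.*-monoˡ-≤-nonNeg (ι (+ b)) {1/ ι (+ b)} {ε} 1/b≤ε)
    where
    1/b≤ε : 1/ ι (+ b) ≤ ε
    1/b≤ε = ℚ.*≤* (ℤ.*-monoʳ-≤-nonNeg (+ b) {+ 1} {+[1+ m ]} (ℤ.+≤+ (ℕ.s≤s ℕ.z≤n)))
  not-far : ¬ ε ≤ ∣ r - 1ℚ ∣
  not-far far = ℕ.<⇒≱ close (ℤ.drop‿+≤+ (ι-cancel-≤ (begin
    ι (+ ℤ.∣ d ∣)
      ≡⟨ ℚ.*-identityˡ (ι (+ ℤ.∣ d ∣)) ⟨
    1ℚ * ι (+ ℤ.∣ d ∣)
      ≤⟨ ℚ.*-monoʳ-≤-nonNeg (ι (+ ℤ.∣ d ∣)) 1≤bε ⟩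
    ι (+ b) * ε * ι (+ ℤ.∣ d ∣)
      ≤⟨ ℚ.*-monoʳ-≤-nonNeg (ι (+ ℤ.∣ d ∣)) (ℚ.*-monoˡ-≤-nonNeg (ι (+ b)) {ε} {∣ r - 1ℚ ∣} far) ⟩
    ι (+ b) * ∣ r - 1ℚ ∣ * ι (+ ℤ.∣ d ∣)
      ≡⟨ ℚ.*-assoc (ι (+ b)) ∣ r - 1ℚ ∣ (ι (+ ℤ.∣ d ∣)) ⟩
    ι (+ b) * (∣ r - 1ℚ ∣ * ι (+ ℤ.∣ d ∣))
      ≡⟨ cong (_*_ (ι (+ b))) ∣scaled∣ ⟩
    ι (+ b) * ι (+ ℤ.∣ a ℤ.- d ∣)
      ≡⟨ trans (ι-* (+ b) (+ ℤ.∣ a ℤ.- d ∣)) (cong ι (sym (ℤ.pos-* b ℤ.∣ a ℤ.- d ∣))) ⟩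
    ι (+ (b ℕ.* ℤ.∣ a ℤ.- d ∣)) ∎)))
    where open ℚ.≤-Reasoning
ratio-close a d {ℚ.mkℚ (+ zero) _ _} (ℚ.*<* (ℤ.+<+ ()))
ratio-close a d {ℚ.mkℚ -[1+ _ ] _ _} (ℚ.*<* ())

E-1 : ∀ n → E 1 n ≡ + 1
E-1 n = identity (+ n)
  where
  identity : ∀ n → (n ℤ.- + 1) ℤ.- + 1 ℤ.* (n ℤ.- + 2) ≡ + 1
  identity = solve-∀

ratio-1 : Ratio (+ 1) (+ 1) 1ℚ
ratio-1 = _ , refl

asymptotic-length-1 : HasAsymptoticLength permutahedra 1 1ℚ
asymptotic-length-1 = (λ _ → + 1) , minimal , limit
  where
  minimal : ∀ n → .{{_ : NonZero n}} → IsMinimumExcess (permutahedron n) 1 (+ 1)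
  minimal (suc m) = minimum-excess-1 m
  limit : Tendsto (λ n → Ratio (+ 1) (E 1 n)) 1ℚ
  -- The distance from 1 computes to zero, so `0<ε` is the required bound.
  limit ε 0<ε = 0 , λ n _ → 1ℚ , subst (λ d → Ratio (+ 1) d 1ℚ) (sym (E-1 n)) ratio-1 , 0<ε

tendsto-1 : ∀ k (e : ℕ → ℤ) → (∀ n m → ℤ.∣ e n ℤ.- E (2 ℕ.+ k) n ∣ ℕ.≤ (2 ℕ.+ k) ℕ.* Fan.levelBound n m (2 ℕ.+ k)) →
            Tendsto (λ n → Ratio (e n) (E (2 ℕ.+ k) n)) 1ℚ
tendsto-1 k e deviation ε 0<ε = threshold , λ n threshold≤n → ratio-close (e n) (E K n) 0<ε (close n threshold≤n)
  where
  K = 2 ℕ.+ k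
  b = ℚ.denominatorℕ ε
  m = 2 ℕ.* (b ℕ.* (K ℕ.* K))
  threshold = 8 ℕ.+ 2 ℕ.* (b ℕ.* (K ℕ.* suc (suc m)))
  close : ∀ n → threshold ℕ.≤ n → b ℕ.* ℤ.∣ e n ℤ.- E K n ∣ ℕ.< ℤ.∣ E K n ∣
  close n threshold≤n = ℕ.≤-<-trans (ℕ.*-monoʳ-≤ b (deviation n m))
    -- The 3 is the slack of `E-large`, which `deviation-small` has already absorbed.
    (ℕ.+-cancelˡ-< 3 (b ℕ.* (K ℕ.* Fan.levelBound n m K)) ℤ.∣ E K n ∣
      (ℕ.<-≤-trans (deviation-small b K (n ℕ./ suc m) n m refl (ℕ.m/n*n≤m n (suc m)) threshold≤n)
        (E-large k n (ℕ.≤-trans (ℕ.s≤s (ℕ.s≤s ℕ.z≤n)) threshold≤n))))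

asymptotic-length-2+ : ∀ k → HasAsymptoticLength permutahedra (2 ℕ.+ k) 1ℚ
asymptotic-length-2+ k = (λ n → proj₁ (minimum-excess n {k})) , (λ n → proj₂ (minimum-excess n {k})) ,
  tendsto-1 k (λ n → proj₁ (minimum-excess n {k})) (excess-deviation k)

asymptotic-length : ∀ k → .{{_ : NonZero k}} → HasAsymptoticLength permutahedra k 1ℚ
asymptotic-length (suc zero)    = asymptotic-length-1
asymptotic-length (suc (suc k)) = asymptotic-length-2+ k

theorem2p1 : (∀ k → .{{_ : NonZero k}} → HasAsymptoticLength permutahedra k 1ℚ)
    × HasAsymptoticTotalLength permutahedra 1ℚ
theorem2p1 = asymptotic-length , (λ _ → 1ℚ) , asymptotic-length , λ ε 0<ε → 0 , λ _ _ → 1ℚ , refl , 0<ε
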